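{- Let $G$ be a graph on $n$ vertices with minimum degree $\delta$. (A) Suppose $G$ is planar. Then: if $\delta = 1$, $\alpha_{2-\mathrm{reg}}(G) \ge \frac{4}{83}(n+3)$; if $\delta = 2$, $\alpha_{2-\mathrm{reg}}(G) \ge \frac{3}{55}(n+4)$; if $\delta = 3$, $\alpha_{2-\mathrm{reg}}(G) \ge \frac{1}{16}(n+4)$; if $\delta = 4$, $\alpha_{2-\mathrm{reg}}(G) \ge \frac{2}{23}(n+6)$; if $\delta = 5$, $\alpha_{2-\mathrm{reg}}(G) \ge \frac{1}{7}(n+12)$. If moreover $G$ is maximal planar and $\delta = 3$, then $\alpha_{2-\mathrm{reg}}(G) \ge \frac{1}{14}(n+6)$. (B) Suppose $G$ is outerplanar and $\delta = 2$. Then $\alpha_{2-\mathrm{reg}}(G) \ge \frac{1}{8}(n+3)$.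
   Context: Graphs are finite and simple. $\alpha_{2-\mathrm{reg}}(G)$ is the maximum cardinality of a set $S$ of vertices of $G$, all having the same degree in $G$, such that the induced subgraph $G[S]$ has maximum degree at most $2$. A maximal planar graph is a planar graph with the maximum possible number of edges for its order $n$ (namely $3n-6$ when $n \ge 3$). -}

module Defs where

open import Data.Bool.Base using (Bool; T)
open import Data.Bool.Properties using (T?)
open import Data.Fin.Base using (Fin)
open import Data.Fin.Properties using (all?; _<?_)
open import Data.Fin.Subset using (Subset; inside; outside; _∈_; _∩_; ∣_∣)
open import Data.Fin.Subset.Properties using (_∈?_)
open import Data.List.Base using (List; []; _∷_; _++_; map; filter; length; allFin; cartesianProduct)
open import Data.List.Extrema.Nat using (max)
open import Data.Nat.Base using (ℕ; zero; suc; _+_; _*_; _≤_)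
open import Data.Nat.Properties using (_≟_; _≤?_)
open import Data.Product.Base using (∃; ∃-syntax; _×_; _,_)
open import Data.Vec.Base as Vec using (tabulate)
open import Function.Base using (_∘_)
open import Function.Bundles using (_↔_; _⇔_; Inverse)
open import Function.Definitions using (Surjective)
open import Relation.Binary.Construct.Closure.ReflexiveTransitive using (Star)
open import Relation.Binary.PropositionalEquality.Core using (_≡_; _≢_)
open import Relation.Nullary using (¬_; Dec)
open import Relation.Nullary.Decidable using (_×-dec_; _→-dec_)

record Graph (n : ℕ) : Set where
  field
    adj    : Fin n → Fin n → Bool
    symm   : ∀ u v → T (adj u v) → T (adj v u)
    irrefl : ∀ v → ¬ T (adj v v)

  Adj : Fin n → Fin n → Set
  Adj u v = T (adj u v)

  neighbours : Fin n → Subset n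
  neighbours v = tabulate (adj v)

  degree : Fin n → ℕ
  degree v = ∣ neighbours v ∣

  edgeList : List (Fin n × Fin n)
  edgeList = filter (λ (u , v) → (u <? v) ×-dec T? (adj u v))
                    (cartesianProduct (allFin n) (allFin n))

  edgeCount : ℕ
  edgeCount = length edgeList

  isolatedCount : ℕ
  isolatedCount = length (filter (λ v → degree v ≟ 0) (allFin n))

  Connected : Fin n → Fin n → Set
  Connected = Star Adj

open Graph public

IsMinDegree : ∀ {n} → Graph n → ℕ → Set
IsMinDegree G δ = (∃[ v ] degree G v ≡ δ) × (∀ v → δ ≤ degree G v)

subsets : ∀ n → List (Subset n)
subsets zero    = Vec.[] ∷ []
subsets (suc n) = map (outside Vec.∷_) (subsets n)
               ++ map (inside  Vec.∷_) (subsets n)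

-- The degree of v in G[S] is ∣ neighbours G v ∩ S ∣.
IsRegularIndependent : ∀ {n} → ℕ → Graph n → Subset n → Set
IsRegularIndependent k G S =
    (∀ u → u ∈ S → ∀ v → v ∈ S → degree G u ≡ degree G v)
  × (∀ v → v ∈ S → ∣ neighbours G v ∩ S ∣ ≤ k)

isRegularIndependent? : ∀ {n} k (G : Graph n) S → Dec (IsRegularIndependent k G S)
isRegularIndependent? k G S =
        all? (λ u → (u ∈? S) →-dec all? (λ v → (v ∈? S) →-dec (degree G u ≟ degree G v)))
  ×-dec all? (λ v → (v ∈? S) →-dec (∣ neighbours G v ∩ S ∣ ≤? k))

-- The base value 0 is attained: the empty set always qualifies.
α-reg : ∀ {n} → ℕ → Graph n → ℕ
α-reg {n} k G = max 0 (map ∣_∣ (filter (isRegularIndependent? k G) (subsets n)))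

-- Each edge gives two darts, one for each orientation.
record Dart {n : ℕ} (G : Graph n) : Set where
  constructor dart
  field
    source : Fin n
    target : Fin n
    edge   : Adj G source target

open Dart public

reverse : ∀ {n} {G : Graph n} → Dart G → Dart G
reverse {G = G} (dart u v e) = dart v u (symm G u v e)

Orbit : {A : Set} → (A → A) → A → A → Set
Orbit f = Star (λ x y → f x ≡ y)

-- A cellular embedding of each component of G in an oriented closed surface,
-- given by the cyclic order of the darts leaving each vertex.
record RotationSystem {n : ℕ} (G : Graph n) : Set where
  field
    rotation  : Dart G ↔ Dart G

  rot : Dart G → Dart G
  rot = Inverse.to rotation

  field
    rot-source : ∀ d → source (rot d) ≡ source d
    rot-cyclic : ∀ d e → source d ≡ source e → Orbit rot d e

  -- Traverse a dart, then leave its target by the next dart in the rotation.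
  -- The orbits of this permutation are the facial walks.
  faceStep : Dart G → Dart G
  faceStep = rot ∘ reverse

  SameFace : Dart G → Dart G → Set
  SameFace = Orbit faceStep

open RotationSystem public

HasClassCount : {A : Set} → (A → A → Set) → ℕ → Set
HasClassCount {A} _~_ k =
  ∃[ class ] Surjective {A = A} {B = Fin k} _≡_ _≡_ class
           × (∀ x y → class x ≡ class y ⇔ x ~ y)

-- Every component lies on a sphere: the Euler formula V - E + F = 2 summed over
-- the c components.  Each component's faces are counted on its own sphere, and
-- an isolated vertex, which has no darts, has one face there.  Every component
-- satisfies V - E + F ≤ 2, so equality of the sums is equality for each.
IsPlane : ∀ {n} {G : Graph n} → RotationSystem G → Set
IsPlane {n} {G} R =
  ∃[ f ] ∃[ c ] HasClassCount (SameFace R) f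
              × HasClassCount (Connected G) c
              × n + (f + isolatedCount G) ≡ edgeCount G + 2 * c

Planar : ∀ {n} → Graph n → Set
Planar G = ∃[ R ] IsPlane {G = G} R

-- Drawings of the components can be placed side by side, so all vertices can
-- lie on the outer face as soon as each component has a face incident with all
-- of its vertices.  Isolated vertices impose no condition.
HasOuterFaces : ∀ {n} {G : Graph n} → RotationSystem G → Set
HasOuterFaces {n} {G} R =
  ∀ r → degree G r ≢ 0 →
    ∃[ d ] (∀ v → Connected G r v → ∃[ e ] source e ≡ v × SameFace R d e)

Outerplanar : ∀ {n} → Graph n → Set
Outerplanar G = ∃[ R ] IsPlane {G = G} R × HasOuterFaces R

MaximalPlanar : ∀ {n} → Graph n → Set
MaximalPlanar {n} G = Planar G × (∀ (H : Graph n) → Planar H → edgeCount H ≤ edgeCount G)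

{-# OPTIONS --safe #-}

-- Write a for α-reg 2 G and n_i for the number of vertices of degree i.  Lovász recolouring
-- (minimise the number of monochromatic edges) splits the vertices of degree i < 3k into k classes
-- of induced maximum degree at most 2, so n_i ≤ k a.  Euler's formula bounds the degree sum by
-- 6n - 12, respectively 4n - 6 in the outerplanar case, which bounds the number of vertices of
-- large degree by the n_i of small i; adding up gives every bound except two.
-- For δ = 1 this loses n₁, which is won back because a face with k ≥ 1 leaf corners has length at
-- least 3 + k/2, unless its component is K₂.
-- For maximal planar graphs the neighbours of a vertex of degree 3 are pairwise adjacent, since a
-- missing edge could be drawn next to that vertex; hence V₃ minus one vertex of each component K₄
-- induces maximum degree at most 2.  The components K₂ and K₄ are paid for by the 12 units that
-- each component contributes to Euler's formula.
module Submission where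

open import Data.Bool.Base using (Bool; true; false; T; _∧_; _∨_; if_then_else_)
open import Data.Bool.Properties using (T?; T-irrelevant; T-∨)
open import Data.Fin.Base using (Fin; zero; suc)
import Data.Fin.Properties as Fin
open import Data.Fin.Subset using (Subset; inside; outside; _∈_; _∩_; ∣_∣)
import Data.Integer.Base as ℤ
import Data.Integer.Properties as ℤ
open import Data.List.Base as List using ([]; _∷_; _++_; length; filter; allFin; cartesianProduct)
open import Data.List.Extrema.Nat using (xs≤max)
import Data.List.Membership.Propositional as List
open import Data.List.Membership.Propositional.Properties using (∈-filter⁺; ∈-map⁺; ∈-++⁺ˡ; ∈-++⁺ʳ)
import Data.List.Properties as List
open import Data.List.Relation.Unary.All as All using (All; []; _∷_)
import Data.List.Relation.Unary.All.Properties as All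
open import Data.List.Relation.Unary.AllPairs using ([]; _∷_)
open import Data.List.Relation.Unary.Any using (here)
open import Data.List.Relation.Unary.Unique.Propositional using (Unique)
open import Data.List.Relation.Unary.Unique.Propositional.Properties using (map⁺; allFin⁺)
open import Data.Nat.Base
open import Data.Nat.DivMod using (m%n<n; m≡m%n+[m/n]*n)
open import Data.Nat.Properties
open import Data.Nat.Tactic.RingSolver using (solve-∀)
open import Data.Product.Base using (∃; ∃-syntax; _×_; _,_; proj₁; proj₂)
import Data.Rational.Unnormalised.Base as ℚ
open import Data.Sum.Base as Sum using (_⊎_; inj₁; inj₂; [_,_]′)
open import Data.Vec.Base as Vec using ([]; _∷_)
open import Data.Vec.Properties using (lookup∘tabulate; []=⇒lookup)
open import Function.Base using (_∘_; case_of_)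
open import Function.Bundles using (Inverse; Equivalence; mk⇔; mk↔ₛ′)
open import Level using (Level)
open import Relation.Binary.Construct.Closure.ReflexiveTransitive using (ε; _◅_; _◅◅_; gmap; kleisliStar)
open import Relation.Binary.Definitions using (tri<; tri≈; tri>)
open import Relation.Binary.PropositionalEquality
open import Relation.Nullary using (¬_; Dec; yes; no; does; contradiction)
open import Relation.Nullary.Decidable using (_×-dec_; _⊎-dec_; _→-dec_; ¬?; ⌊_⌋; map′; toWitness; fromWitness; decidable-stable)
open import Relation.Unary using (Pred; Decidable)
open import Defs

import Algebra.Properties.Semiring.Sum +-*-semiring as ℕ-Sum

-- Each bound fixes a threshold t above the mean degree. Summing the positive parts of t - degree v
-- gives t n ≤ 2E + ∑ (t - i) n_i, so in the planar case (t - 6) n + 12 ≤ ∑ (t - i) n_i. With n_i ≤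
-- (⌊i/3⌋ + 1) a the right side becomes a multiple of a, and its factor is the denominator, up to
-- cancellation. The thresholds are 10, 9, 9, 8, 7 for δ = 1, ..., 5, then 8 for maximal planar
-- graphs and 6 for outerplanar ones. Without the refund of n₁ the case δ = 1 would give 84 = 9 + 75
-- instead of 83; without the special treatment of degree 3 the maximal planar case would give 33
-- instead of 28 = 2 * 14. Connectedness is not assumed. An exceptional component K₂ or K₄ is a real
-- obstacle only when it is the whole graph, since a second component brings 12 further units; in
-- that case the graph is regular and is counted directly. Planarity is combinatorial: to draw an
-- edge means to insert two darts into a rotation system, and what has to be proved is that exactly
-- one face is split and that the components stay the same.

private
  variable
    p q : Level
    A : Set
    P : Set p
    Q : Set q
    m n : ℕ

-- Indicators and finite sums

𝟙 : Dec P → ℕ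
𝟙 P? = if does P? then 1 else 0

𝟙≤1 : (P? : Dec P) → 𝟙 P? ≤ 1
𝟙≤1 (yes _) = ≤-refl
𝟙≤1 (no _)  = z≤n

𝟙-yes : (P? : Dec P) → P → 𝟙 P? ≡ 1
𝟙-yes (yes _) x = refl
𝟙-yes (no ¬x) x = contradiction x ¬x

𝟙-no : (P? : Dec P) → ¬ P → 𝟙 P? ≡ 0
𝟙-no (yes x) ¬x = contradiction x ¬x
𝟙-no (no _)  ¬x = refl

𝟙-pos : (P? : Dec P) → 1 ≤ 𝟙 P? → P
𝟙-pos (yes x) _ = x

𝟙-mono : (P? : Dec P) (Q? : Dec Q) → (P → Q) → 𝟙 P? ≤ 𝟙 Q?
𝟙-mono (yes x) Q? f = ≤-reflexive (sym (𝟙-yes Q? (f x)))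
𝟙-mono (no _)  Q? f = z≤n

𝟙-cong : (P? : Dec P) (Q? : Dec Q) → (P → Q) → (Q → P) → 𝟙 P? ≡ 𝟙 Q?
𝟙-cong P? Q? f g = ≤-antisym (𝟙-mono P? Q? f) (𝟙-mono Q? P? g)

𝟙-× : (P? : Dec P) (Q? : Dec Q) → 𝟙 (P? ×-dec Q?) ≡ 𝟙 P? * 𝟙 Q?
𝟙-× (yes _) (yes _) = refl
𝟙-× (yes _) (no _)  = refl
𝟙-× (no _)  _       = refl

𝟙-exclusive : (P? : Dec P) (Q? : Dec Q) → ¬ (P × Q) → 𝟙 P? + 𝟙 Q? ≤ 1
𝟙-exclusive (yes x) (yes y) ¬xy = contradiction (x , y) ¬xy
𝟙-exclusive (yes _) (no _)  _   = ≤-refl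
𝟙-exclusive (no _)  Q?      _   = 𝟙≤1 Q?

*-pos : ∀ a b → 1 ≤ a * b → 1 ≤ a × 1 ≤ b
*-pos (suc a) (suc b) _ = s≤s z≤n , s≤s z≤n
*-pos (suc a) zero    l rewrite *-zeroʳ a = contradiction l λ ()

opaque
  ∑ : (Fin n → ℕ) → ℕ
  ∑ = ℕ-Sum.sum

  ∑-cong : {f g : Fin n → ℕ} → (∀ i → f i ≡ g i) → ∑ f ≡ ∑ g
  ∑-cong = ℕ-Sum.sum-cong-≗

  ∑-+ : (f g : Fin n → ℕ) → ∑ (λ i → f i + g i) ≡ ∑ f + ∑ g
  ∑-+ = ℕ-Sum.∑-distrib-+

  ∑-* : ∀ c (f : Fin n → ℕ) → ∑ (λ i → c * f i) ≡ c * ∑ f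
  ∑-* c f = sym (ℕ-Sum.*-distribˡ-sum c f)

  ∑-comm : (f : Fin m → Fin n → ℕ) → ∑ (λ i → ∑ (f i)) ≡ ∑ (λ j → ∑ (λ i → f i j))
  ∑-comm = ℕ-Sum.∑-comm

  ∑-suc : (f : Fin (suc n) → ℕ) → ∑ f ≡ f zero + ∑ (f ∘ suc)
  ∑-suc f = refl

  ∑-mono : {f g : Fin n → ℕ} → (∀ i → f i ≤ g i) → ∑ f ≤ ∑ g
  ∑-mono {zero}  f≤g = z≤n
  ∑-mono {suc n} f≤g = +-mono-≤ (f≤g zero) (∑-mono (f≤g ∘ suc))

  ∑-const : ∀ n c → ∑ {n} (λ _ → c) ≡ n * c
  ∑-const zero    c = refl
  ∑-const (suc n) c = cong (c +_) (∑-const n c)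

  ∑-term : (f : Fin n → ℕ) (i : Fin n) → f i ≤ ∑ f
  ∑-term f zero    = m≤m+n _ _
  ∑-term f (suc i) = ≤-trans (∑-term (f ∘ suc) i) (m≤n+m _ _)

  ∑-zero : {f : Fin n → ℕ} → (∀ i → f i ≡ 0) → ∑ f ≡ 0
  ∑-zero {n} f≡0 = trans (∑-cong f≡0) (trans (∑-const n 0) (*-zeroʳ n))

  ∑-pos : (f : Fin n → ℕ) → 1 ≤ ∑ f → ∃ λ i → 1 ≤ f i
  ∑-pos {suc n} f l with f zero in eq
  ... | suc _ = zero , subst (1 ≤_) (sym eq) (s≤s z≤n)
  ... | zero  = let i , l′ = ∑-pos (f ∘ suc) l in suc i , l′

  ∑-atMostOne : ∀ {b} (f : Fin n → ℕ) → (∀ i → f i ≤ b) →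
                (∀ i j → 1 ≤ f i → 1 ≤ f j → i ≡ j) → ∑ f ≤ b
  ∑-atMostOne {zero}  f f≤b uniq = z≤n
  ∑-atMostOne {suc n} {b} f f≤b uniq with f zero in eq
  ... | zero  = ∑-atMostOne (f ∘ suc) (f≤b ∘ suc) (λ i j k l → Fin.suc-injective (uniq (suc i) (suc j) k l))
  ... | suc x = begin
    suc x + ∑ (f ∘ suc) ≡⟨ cong (suc x +_) (∑-zero rest) ⟩
    suc x + 0             ≡⟨ +-identityʳ (suc x) ⟩
    suc x                 ≡⟨ eq ⟨
    f zero                ≤⟨ f≤b zero ⟩
    b                     ∎
    where
    open ≤-Reasoning
    rest : ∀ i → f (suc i) ≡ 0
    rest i with f (suc i) in eq′
    ... | zero  = refl
    ... | suc _ with () ← uniq zero (suc i) (subst (1 ≤_) (sym eq) (s≤s z≤n)) (subst (1 ≤_) (sym eq′) (s≤s z≤n))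

  ∑-point : (j : Fin n) (f : Fin n → ℕ) → ∑ (λ i → 𝟙 (j Fin.≟ i) * f i) ≡ f j
  ∑-point {suc n} zero f = begin
    f zero + 0 + ∑ {n} (λ _ → 0) ≡⟨ cong (f zero + 0 +_) (∑-zero {n} (λ _ → refl)) ⟩
    f zero + 0 + 0                 ≡⟨ trans (+-identityʳ _) (+-identityʳ _) ⟩
    f zero                         ∎
    where open ≡-Reasoning
  ∑-point {suc n} (suc j) f = trans (∑-cong step) (∑-point j (f ∘ suc))
    where
    step : ∀ i → 𝟙 (suc j Fin.≟ suc i) * f (suc i) ≡ 𝟙 (j Fin.≟ i) * f (suc i)
    step i = cong (_* f (suc i)) (𝟙-cong (suc j Fin.≟ suc i) (j Fin.≟ i) Fin.suc-injective (cong suc))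

∑-𝟙-point : (j : Fin n) → ∑ (λ i → 𝟙 (j Fin.≟ i)) ≡ 1
∑-𝟙-point j = trans (∑-cong (λ i → sym (*-identityʳ (𝟙 (j Fin.≟ i))))) (∑-point j (λ _ → 1))

-- Sums over the darts of a graph

module DartSum {n : ℕ} (G : Graph n) where

  dart-≡ : {d e : Dart G} → source d ≡ source e → target d ≡ target e → d ≡ e
  dart-≡ {dart u v a} {dart u v b} refl refl = cong (dart u v) (T-irrelevant a b)

  infix 4 _≟ᴰ_
  _≟ᴰ_ : (d e : Dart G) → Dec (d ≡ e)
  d ≟ᴰ e = map′ (λ (s , t) → dart-≡ s t) (λ { refl → refl , refl })
                (source d Fin.≟ source e ×-dec target d Fin.≟ target e)

  edge? : ∀ u v → Dec (Adj G u v)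
  edge? u v = T? (adj G u v)

  -- The decision is an argument, so that proofs can split on it and a dart can be compared with
  -- whatever proof of adjacency the decision contains.
  onEdge : (Dart G → ℕ) → ∀ u v → Dec (Adj G u v) → ℕ
  onEdge h u v (yes e) = h (dart u v e)
  onEdge h u v (no _)  = 0

  ∑ᴰ : (Dart G → ℕ) → ℕ
  ∑ᴰ h = ∑ λ u → ∑ λ v → onEdge h u v (edge? u v)

  private
    onEdge-mono : ∀ {h k} → (∀ d → h d ≤ k d) → ∀ u v a → onEdge h u v a ≤ onEdge k u v a
    onEdge-mono h≤k u v (yes e) = h≤k _
    onEdge-mono h≤k u v (no _)  = z≤n

    onEdge-dart : ∀ h d a → onEdge h (source d) (target d) a ≡ h d
    onEdge-dart h d (yes e) = cong h (dart-≡ refl refl)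
    onEdge-dart h d (no ¬e) = contradiction (edge d) ¬e

    onEdge-pos : ∀ h u v a → 1 ≤ onEdge h u v a → ∃ λ d → source d ≡ u × target d ≡ v × 1 ≤ h d
    onEdge-pos h u v (yes e) l = dart u v e , refl , refl , l

  ∑ᴰ-mono : ∀ {h k} → (∀ d → h d ≤ k d) → ∑ᴰ h ≤ ∑ᴰ k
  ∑ᴰ-mono h≤k = ∑-mono λ u → ∑-mono λ v → onEdge-mono h≤k u v (edge? u v)

  ∑ᴰ-cong : ∀ {h k} → (∀ d → h d ≡ k d) → ∑ᴰ h ≡ ∑ᴰ k
  ∑ᴰ-cong h≡k = ≤-antisym (∑ᴰ-mono (≤-reflexive ∘ h≡k)) (∑ᴰ-mono (≤-reflexive ∘ sym ∘ h≡k))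

  ∑ᴰ-+ : ∀ h k → ∑ᴰ (λ d → h d + k d) ≡ ∑ᴰ h + ∑ᴰ k
  ∑ᴰ-+ h k = trans (∑-cong λ u → trans (∑-cong λ v → pointwise u v (edge? u v)) (∑-+ _ _)) (∑-+ _ _)
    where
    pointwise : ∀ u v a → onEdge (λ d → h d + k d) u v a ≡ onEdge h u v a + onEdge k u v a
    pointwise u v (yes e) = refl
    pointwise u v (no _)  = refl

  ∑ᴰ-comm : (h : Fin m → Dart G → ℕ) → ∑ (λ j → ∑ᴰ (h j)) ≡ ∑ᴰ (λ d → ∑ (λ j → h j d))
  ∑ᴰ-comm {m} h = trans (∑-comm _) (∑-cong λ u → trans (∑-comm _) (∑-cong λ v → pointwise u v (edge? u v)))
    where
    pointwise : ∀ u v a → ∑ (λ j → onEdge (h j) u v a) ≡ onEdge (λ d → ∑ (λ j → h j d)) u v a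
    pointwise u v (yes e) = refl
    pointwise u v (no _)  = ∑-zero {m} (λ _ → refl)

  ∑ᴰ-term : ∀ h d → h d ≤ ∑ᴰ h
  ∑ᴰ-term h d = begin
    h d                                         ≡⟨ onEdge-dart h d (edge? (source d) (target d)) ⟨
    onEdge h (source d) (target d) (edge? (source d) (target d))       ≤⟨ ∑-term (λ v → onEdge h (source d) v (edge? _ _)) (target d) ⟩
    ∑ (λ v → onEdge h (source d) v (edge? _ _))    ≤⟨ ∑-term (λ u → ∑ (λ v → onEdge h u v (edge? _ _))) (source d) ⟩
    ∑ᴰ h                                        ∎
    where open ≤-Reasoning

  ∑ᴰ-pos : ∀ h → 1 ≤ ∑ᴰ h → ∃ λ d → 1 ≤ h d
  ∑ᴰ-pos h l with u , l₁ ← ∑-pos _ l with v , l₂ ← ∑-pos _ l₁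
    with d , _ , _ , l₃ ← onEdge-pos h u v (edge? u v) l₂ = d , l₃

  ∑ᴰ-reverse : ∀ h → ∑ᴰ (h ∘ reverse) ≡ ∑ᴰ h
  ∑ᴰ-reverse h = trans (∑-cong λ u → ∑-cong λ v → pointwise u v (edge? u v) (edge? v u)) (∑-comm _)
    where
    pointwise : ∀ u v a b → onEdge (h ∘ reverse) u v a ≡ onEdge h v u b
    pointwise u v (yes e) b      = sym (onEdge-dart h (reverse (dart u v e)) b)
    pointwise u v (no ¬e) (yes e) = contradiction (symm G v u e) ¬e
    pointwise u v (no ¬e) (no _)  = refl

  ∑ᴰ-source : ∀ f → ∑ᴰ (f ∘ source) ≡ ∑ (λ u → f u * ∑ (λ v → 𝟙 (edge? u v)))
  ∑ᴰ-source f = ∑-cong λ u → trans (∑-cong λ v → pointwise u v (edge? u v))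
                                       (∑-* (f u) (λ v → 𝟙 (edge? u v)))
    where
    pointwise : ∀ u v a → onEdge (f ∘ source) u v a ≡ f u * 𝟙 a
    pointwise u v (yes e) = sym (*-identityʳ (f u))
    pointwise u v (no _)  = sym (*-zeroʳ (f u))

  -- Lower bounds on face lengths and degrees come from here: it is enough to exhibit distinct
  -- darts. The induction sets the weight at the head to 0; distinctness keeps the weights along the
  -- tail positive.
  ∑ᴰ-unique : ∀ h {ds} → Unique ds → All (λ d → 1 ≤ h d) ds → length ds ≤ ∑ᴰ h
  ∑ᴰ-unique h []                     []       = z≤n
  ∑ᴰ-unique h {d ∷ ds} (d∉ds ∷ ds!) (l ∷ ls) = begin
    1 + length ds                          ≤⟨ +-mono-≤ one (∑ᴰ-unique h′ ds! (All.zipWith still-pos (d∉ds , ls))) ⟩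
    ∑ᴰ (λ e → 𝟙 (d ≟ᴰ e)) + ∑ᴰ h′          ≡⟨ ∑ᴰ-+ _ _ ⟨
    ∑ᴰ (λ e → 𝟙 (d ≟ᴰ e) + h′ e)           ≤⟨ ∑ᴰ-mono below ⟩
    ∑ᴰ h                                   ∎
    where
    open ≤-Reasoning
    h′ : Dart G → ℕ
    h′ e = (1 ∸ 𝟙 (d ≟ᴰ e)) * h e
    still-pos : ∀ {e} → (d ≢ e) × 1 ≤ h e → 1 ≤ h′ e
    still-pos {e} (d≢e , l′) rewrite 𝟙-no (d ≟ᴰ e) d≢e | +-identityʳ (h e) = l′
    below : ∀ e → 𝟙 (d ≟ᴰ e) + h′ e ≤ h e
    below e = case d ≟ᴰ e of λ
      { (yes refl) → subst (λ x → x + (1 ∸ x) * h d ≤ h d) (sym (𝟙-yes (d ≟ᴰ d) refl)) l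
      ; (no d≢e)   → subst (λ x → x + (1 ∸ x) * h e ≤ h e) (sym (𝟙-no (d ≟ᴰ e) d≢e)) (≤-reflexive (+-identityʳ (h e)))
      }
    one : 1 ≤ ∑ᴰ (λ e → 𝟙 (d ≟ᴰ e))
    one = ≤-trans (≤-reflexive (sym (𝟙-yes (d ≟ᴰ d) refl))) (∑ᴰ-term (λ e → 𝟙 (d ≟ᴰ e)) d)

-- Degrees, edges and regular independent sets

∣tabulate∣ : (f : Fin n → Bool) → ∣ Vec.tabulate f ∣ ≡ ∑ (λ i → 𝟙 (T? (f i)))
∣tabulate∣ {zero}  f = sym (∑-zero {f = λ i → 𝟙 (T? (f i))} λ ())
∣tabulate∣ {suc n} f = trans (step (f zero)) (sym (∑-suc _))
  where
  step : ∀ b → ∣ b ∷ Vec.tabulate (f ∘ suc) ∣ ≡ 𝟙 (T? b) + ∑ (λ i → 𝟙 (T? (f (suc i))))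
  step true  = cong suc (∣tabulate∣ (f ∘ suc))
  step false = ∣tabulate∣ (f ∘ suc)

∣tabulate∩tabulate∣ : (f g : Fin n → Bool) →
  ∣ Vec.tabulate f ∩ Vec.tabulate g ∣ ≡ ∑ (λ i → 𝟙 (T? (f i)) * 𝟙 (T? (g i)))
∣tabulate∩tabulate∣ {zero}  f g = sym (∑-zero {f = λ i → 𝟙 (T? (f i)) * 𝟙 (T? (g i))} λ ())
∣tabulate∩tabulate∣ {suc n} f g = trans (step (f zero) (g zero)) (sym (∑-suc _))
  where
  step : ∀ b c → ∣ (b ∧ c) ∷ (Vec.tabulate (f ∘ suc) ∩ Vec.tabulate (g ∘ suc)) ∣
               ≡ 𝟙 (T? b) * 𝟙 (T? c) + ∑ (λ i → 𝟙 (T? (f (suc i))) * 𝟙 (T? (g (suc i))))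
  step true  true  = cong suc (∣tabulate∩tabulate∣ (f ∘ suc) (g ∘ suc))
  step true  false = ∣tabulate∩tabulate∣ (f ∘ suc) (g ∘ suc)
  step false _     = ∣tabulate∩tabulate∣ (f ∘ suc) (g ∘ suc)

length-filter-∷ : {P : Pred A p} (P? : Decidable P) → ∀ x xs →
                  length (filter P? (x ∷ xs)) ≡ 𝟙 (P? x) + length (filter P? xs)
length-filter-∷ P? x xs with P? x
... | yes _ = refl
... | no _  = refl

length-filter-tabulate : {P : Pred A p} (P? : Decidable P) (f : Fin n → A) →
                         length (filter P? (List.tabulate f)) ≡ ∑ (λ i → 𝟙 (P? (f i)))
length-filter-tabulate {n = zero}  P? f = sym (∑-zero {f = λ i → 𝟙 (P? (f i))} λ ())
length-filter-tabulate {n = suc n} P? f = begin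
  length (filter P? (List.tabulate f))                            ≡⟨ length-filter-∷ P? _ _ ⟩
  𝟙 (P? (f zero)) + length (filter P? (List.tabulate (f ∘ suc))) ≡⟨ cong (_ +_) (length-filter-tabulate P? (f ∘ suc)) ⟩
  𝟙 (P? (f zero)) + ∑ (λ i → 𝟙 (P? (f (suc i))))                 ≡⟨ ∑-suc _ ⟨
  ∑ (λ i → 𝟙 (P? (f i)))                                         ∎
  where open ≡-Reasoning

length-filter-cartesianProduct :
  {P : Pred (Fin n × Fin n) p} (P? : Decidable P) (f : Fin m → Fin n) →
  length (filter P? (cartesianProduct (List.tabulate f) (allFin n))) ≡ ∑ (λ i → ∑ (λ j → 𝟙 (P? (f i , j))))
length-filter-cartesianProduct {n = n} {m = zero}  P? f = sym (∑-zero {f = λ i → ∑ (λ j → 𝟙 (P? (f i , j)))} λ ())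
length-filter-cartesianProduct {n = n} {m = suc m} P? f = begin
  length (filter P? (row ++ rest))                       ≡⟨ cong length (List.filter-++ P? row rest) ⟩
  length (filter P? row ++ filter P? rest)               ≡⟨ List.length-++ (filter P? row) ⟩
  length (filter P? row) + length (filter P? rest)       ≡⟨ cong₂ _+_ row-sum (length-filter-cartesianProduct P? (f ∘ suc)) ⟩
  ∑ (λ j → 𝟙 (P? (f zero , j))) + ∑ (λ i → ∑ (λ j → 𝟙 (P? (f (suc i) , j)))) ≡⟨ ∑-suc _ ⟨
  ∑ (λ i → ∑ (λ j → 𝟙 (P? (f i , j))))                   ∎
  where
  open ≡-Reasoning
  row  = List.map (f zero ,_) (allFin n)
  rest = cartesianProduct (List.tabulate (f ∘ suc)) (allFin n)
  row-sum : length (filter P? row) ≡ ∑ (λ j → 𝟙 (P? (f zero , j)))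
  row-sum = trans (cong (length ∘ filter P?) (List.map-tabulate (λ j → j) (f zero ,_)))
                  (length-filter-tabulate P? (f zero ,_))

∈-subsets : (S : Subset n) → S List.∈ subsets n
∈-subsets []           = here refl
∈-subsets (outside ∷ S) = ∈-++⁺ˡ (∈-map⁺ (outside ∷_) (∈-subsets S))
∈-subsets (inside ∷ S)  = ∈-++⁺ʳ _ (∈-map⁺ (inside ∷_) (∈-subsets S))

module _ {n : ℕ} (G : Graph n) where

  open DartSum G

  degree-∑ : ∀ v → degree G v ≡ ∑ (λ u → 𝟙 (edge? v u))
  degree-∑ v = ∣tabulate∣ (adj G v)

  ∑ᴰ-degree : ∀ f → ∑ᴰ (f ∘ source) ≡ ∑ (λ v → f v * degree G v)
  ∑ᴰ-degree f = trans (∑ᴰ-source f) (∑-cong λ v → cong (f v *_) (sym (degree-∑ v)))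

  ∑ᴰ-1 : ∑ᴰ (λ _ → 1) ≡ ∑ (degree G)
  ∑ᴰ-1 = trans (∑ᴰ-degree (λ _ → 1)) (∑-cong λ v → *-identityˡ (degree G v))

  handshake : ∑ (degree G) ≡ 2 * edgeCount G
  handshake = begin
    ∑ (degree G)                                                     ≡⟨ ∑-cong degree-∑ ⟩
    ∑ (λ u → ∑ (λ v → 𝟙 (edge? u v)))                               ≡⟨ (∑-cong λ u → ∑-cong λ v → orient u v) ⟩
    ∑ (λ u → ∑ (λ v → up u v + up v u))                              ≡⟨ (∑-cong λ u → ∑-+ (up u) (λ v → up v u)) ⟩
    ∑ (λ u → ∑ (up u) + ∑ (λ v → up v u))                            ≡⟨ ∑-+ (λ u → ∑ (up u)) (λ u → ∑ (λ v → up v u)) ⟩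
    ∑ (λ u → ∑ (up u)) + ∑ (λ u → ∑ (λ v → up v u))                  ≡⟨ cong (∑ (λ u → ∑ (up u)) +_) (∑-comm (λ u v → up v u)) ⟩
    ∑ (λ u → ∑ (up u)) + ∑ (λ u → ∑ (up u))                          ≡⟨ cong₂ _+_ count (trans count (sym (+-identityʳ _))) ⟩
    2 * edgeCount G                                                  ∎
    where
    open ≡-Reasoning
    up : Fin n → Fin n → ℕ
    up u v = 𝟙 ((u Fin.<? v) ×-dec edge? u v)
    count : ∑ (λ u → ∑ (up u)) ≡ edgeCount G
    count = sym (length-filter-cartesianProduct {P = λ (u , v) → _} (λ (u , v) → (u Fin.<? v) ×-dec edge? u v) (λ u → u))
    -- `edgeCount` lists an edge only in its increasing order, so exactly one of the two terms sees
    -- it.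
    orient : ∀ u v → 𝟙 (edge? u v) ≡ up u v + up v u
    orient u v = case Fin.<-cmp u v of λ
      { (tri< u<v _ v≮u) → begin
          𝟙 (edge? u v)          ≡⟨ 𝟙-cong (edge? u v) ((u Fin.<? v) ×-dec edge? u v) (u<v ,_) proj₂ ⟩
          up u v                  ≡⟨ +-identityʳ _ ⟨
          up u v + 0              ≡⟨ cong (up u v +_) (𝟙-no ((v Fin.<? u) ×-dec edge? v u) (v≮u ∘ proj₁)) ⟨
          up u v + up v u         ∎
      ; (tri≈ u≮v refl _) → begin
          𝟙 (edge? u v)          ≡⟨ 𝟙-no (edge? u v) (irrefl G u) ⟩
          0                       ≡⟨ cong₂ _+_ (𝟙-no ((u Fin.<? v) ×-dec edge? u v) (u≮v ∘ proj₁)) (𝟙-no ((u Fin.<? v) ×-dec edge? u v) (u≮v ∘ proj₁)) ⟨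
          up u v + up v u         ∎
      ; (tri> u≮v _ v<u) → begin
          𝟙 (edge? u v)          ≡⟨ 𝟙-cong (edge? u v) ((v Fin.<? u) ×-dec edge? v u) (λ e → v<u , symm G u v e) (symm G v u ∘ proj₂) ⟩
          up v u                  ≡⟨ cong (_+ up v u) (𝟙-no ((u Fin.<? v) ×-dec edge? u v) (u≮v ∘ proj₁)) ⟨
          up u v + up v u         ∎
      }

  module _ {P : Pred (Fin n) p} (P? : Decidable P) where

    private
      S : Subset n
      S = Vec.tabulate (does ∘ P?)

      ∈S⇒P : ∀ {v} → v ∈ S → P v
      ∈S⇒P {v} v∈S with P? v | trans (sym (lookup∘tabulate (does ∘ P?) v)) ([]=⇒lookup v∈S)
      ... | yes Pv | _ = Pv

      𝟙-does : ∀ v → 𝟙 (T? (does (P? v))) ≡ 𝟙 (P? v)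
      𝟙-does v with P? v
      ... | yes _ = refl
      ... | no _  = refl

    -- Sets enter as decidable predicates, which turns their size and their induced degrees into
    -- sums of indicators. The bound follows because `α-reg` is a maximum over a list that contains
    -- every qualifying subset.
    α-reg-≥ : ∀ k → (∀ u v → P u → P v → degree G u ≡ degree G v) →
              (∀ v → P v → ∑ (λ u → 𝟙 (edge? v u) * 𝟙 (P? u)) ≤ k) →
              ∑ (λ v → 𝟙 (P? v)) ≤ α-reg k G
    α-reg-≥ k regular sparse = begin
      ∑ (λ v → 𝟙 (P? v))             ≡⟨ ∑-cong 𝟙-does ⟨
      ∑ (λ v → 𝟙 (T? (does (P? v)))) ≡⟨ ∣tabulate∣ (does ∘ P?) ⟨
      ∣ S ∣                          ≤⟨ All.lookup (xs≤max 0 _) (∈-map⁺ ∣_∣ (∈-filter⁺ (isRegularIndependent? k G) (∈-subsets S) S-independent)) ⟩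
      α-reg k G                      ∎
      where
      open ≤-Reasoning
      S-independent : IsRegularIndependent k G S
      S-independent = (λ u u∈S v v∈S → regular u v (∈S⇒P u∈S) (∈S⇒P v∈S)) , λ v v∈S → begin
        ∣ neighbours G v ∩ S ∣                           ≡⟨ ∣tabulate∩tabulate∣ (adj G v) (does ∘ P?) ⟩
        ∑ (λ u → 𝟙 (edge? v u) * 𝟙 (T? (does (P? u)))) ≡⟨ (∑-cong λ u → cong (𝟙 (edge? v u) *_) (𝟙-does u)) ⟩
        ∑ (λ u → 𝟙 (edge? v u) * 𝟙 (P? u))             ≤⟨ sparse v (∈S⇒P v∈S) ⟩
        k                                                ∎

-- Lovász recolouring

-- Weights `a` in place of a graph allow the adjacency to be restricted to the vertices of one
-- degree while every vertex is still coloured.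
module Recolour {n k : ℕ} (a : Fin n → Fin n → ℕ) (a-sym : ∀ u v → a u v ≡ a v u) (a-diag : ∀ v → a v v ≡ 0) where

  same : (Fin n → Fin k) → Fin n → Fin k → ℕ
  same χ v c = ∑ (λ u → a v u * 𝟙 (c Fin.≟ χ u))

  -- Monochromatic edges are seen from both ends, whence the doubled terms in `energy-recolour`.
  energy : (Fin n → Fin k) → ℕ
  energy χ = ∑ (λ v → same χ v (χ v))

  recolour : (Fin n → Fin k) → Fin n → Fin k → Fin n → Fin k
  recolour χ v c u = if does (v Fin.≟ u) then c else χ u

  -- Only pairs involving `v` change. Old and new contributions are added on opposite sides because
  -- subtraction on ℕ truncates.
  energy-recolour : ∀ χ v c → energy (recolour χ v c) + (same χ v (χ v) + same χ v (χ v))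
                            ≡ energy χ + (same χ v c + same χ v c)
  energy-recolour χ v c = begin
    energy χ′ + (same χ v (χ v) + same χ v (χ v))                      ≡⟨ split χ′ (χ v) ⟨
    ∑ (λ u → ∑ (λ w → g χ′ u w + (row (χ v) u w + row (χ v) w u)))     ≡⟨ (∑-cong λ u → ∑-cong λ w → pointwise u w) ⟩
    ∑ (λ u → ∑ (λ w → g χ u w + (row c u w + row c w u)))              ≡⟨ split χ c ⟩
    energy χ + (same χ v c + same χ v c)                               ∎
    where
    open ≡-Reasoning
    χ′ = recolour χ v c
    g : (Fin n → Fin k) → Fin n → Fin n → ℕ
    g ψ u w = a u w * 𝟙 (ψ u Fin.≟ ψ w)
    -- `row d` holds the monochromatic pairs at `v` if `v` had colour `d`; its transpose holds the
    -- same pairs seen from the other end. Once the old rows are added to the new energy and the new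
    -- rows to the old one, the two double sums agree entry by entry.
    row : Fin k → Fin n → Fin n → ℕ
    row d u w = 𝟙 (v Fin.≟ u) * (a v w * 𝟙 (d Fin.≟ χ w))
    row-sum : ∀ d → ∑ (λ u → ∑ (row d u)) ≡ same χ v d
    row-sum d = trans (∑-cong λ u → ∑-* (𝟙 (v Fin.≟ u)) (λ w → a v w * 𝟙 (d Fin.≟ χ w))) (∑-point v (λ _ → same χ v d))
    split : ∀ ψ d → ∑ (λ u → ∑ (λ w → g ψ u w + (row d u w + row d w u))) ≡ energy ψ + (same χ v d + same χ v d)
    split ψ d = begin
      ∑ (λ u → ∑ (λ w → g ψ u w + (row d u w + row d w u)))
        ≡⟨ (∑-cong λ u → trans (∑-+ (g ψ u) _) (cong (∑ (g ψ u) +_) (∑-+ (row d u) (λ w → row d w u)))) ⟩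
      ∑ (λ u → ∑ (g ψ u) + (∑ (row d u) + ∑ (λ w → row d w u)))
        ≡⟨ trans (∑-+ _ _) (cong (energy ψ +_) (∑-+ _ _)) ⟩
      energy ψ + (∑ (λ u → ∑ (row d u)) + ∑ (λ u → ∑ (λ w → row d w u)))
        ≡⟨ cong (energy ψ +_) (cong₂ _+_ (row-sum d) (trans (∑-comm (λ u w → row d w u)) (row-sum d))) ⟩
      energy ψ + (same χ v d + same χ v d) ∎
    both : ∀ x y z w → a v v * x + (a v v * y + 0 + (a v v * y + 0)) ≡ a v v * z + (a v v * w + 0 + (a v v * w + 0))
    both x y z w rewrite a-diag v = refl
    left : ∀ x y → x + (y + 0 + 0) ≡ y + (x + 0 + 0)
    left = solve-∀
    right : ∀ x y → x + (0 + (y + 0)) ≡ y + (0 + (x + 0))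
    right = solve-∀
    flip-edge : ∀ u d e → a u v * 𝟙 (d Fin.≟ e) ≡ a v u * 𝟙 (e Fin.≟ d)
    flip-edge u d e = cong₂ _*_ (a-sym u v) (𝟙-cong (d Fin.≟ e) (e Fin.≟ d) sym sym)
    pointwise : ∀ u w → g χ′ u w + (row (χ v) u w + row (χ v) w u) ≡ g χ u w + (row c u w + row c w u)
    pointwise u w with v Fin.≟ u | v Fin.≟ w
    ... | yes refl | yes refl = both _ _ _ _
    ... | yes refl | no _     = left (a v w * 𝟙 (c Fin.≟ χ w)) (a v w * 𝟙 (χ v Fin.≟ χ w))
    ... | no _     | yes refl = trans (cong (_+ (0 + (a v u * 𝟙 (χ v Fin.≟ χ u) + 0))) (flip-edge u (χ u) c))
                               (trans (right (a v u * 𝟙 (c Fin.≟ χ u)) (a v u * 𝟙 (χ v Fin.≟ χ u))) (cong (_+ (0 + (a v u * 𝟙 (c Fin.≟ χ u) + 0))) (sym (flip-edge u (χ u) (χ v)))))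
    ... | no _     | no _     = refl

  module _ (t : ℕ) (row-bound : ∀ v → ∑ (a v) < k * suc t) where

    ∑-same : ∀ χ v → ∑ (same χ v) ≡ ∑ (a v)
    ∑-same χ v = begin
      ∑ (λ c → ∑ (λ u → a v u * 𝟙 (c Fin.≟ χ u)))  ≡⟨ ∑-comm _ ⟩
      ∑ (λ u → ∑ (λ c → a v u * 𝟙 (c Fin.≟ χ u)))  ≡⟨ (∑-cong λ u → trans (∑-* (a v u) (λ c → 𝟙 (c Fin.≟ χ u))) (cong (a v u *_) (one u))) ⟩
      ∑ (λ u → a v u * 1)                          ≡⟨ (∑-cong λ u → *-identityʳ (a v u)) ⟩
      ∑ (a v)                                      ∎
      where
      open ≡-Reasoning
      one : ∀ u → ∑ (λ c → 𝟙 (c Fin.≟ χ u)) ≡ 1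
      one u = trans (∑-cong λ c → 𝟙-cong (c Fin.≟ χ u) (χ u Fin.≟ c) sym sym) (∑-𝟙-point (χ u))

    -- Pigeonhole: weight at least `suc t` in each of the `k` colours would exceed the row sum.
    sparse-colour : ∀ χ v → ∃ λ c → same χ v c ≤ t
    sparse-colour χ v with Fin.any? (λ c → same χ v c ≤? t)
    ... | yes found = found
    ... | no  none  = contradiction (row-bound v) (≤⇒≯ (begin
      k * suc t        ≡⟨ ∑-const k (suc t) ⟨
      ∑ (λ (c : Fin k) → suc t) ≤⟨ (∑-mono λ c → ≰⇒> λ l → none (c , l)) ⟩
      ∑ (same χ v)     ≡⟨ ∑-same χ v ⟩
      ∑ (a v)          ∎))
      where open ≤-Reasoning

    -- Moving a vertex with more than `t` conflicts to a sparse colour strictly lowers the energy,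
    -- so the descent from any start terminates; `bound` is an upper bound on the energy that drives
    -- the recursion.
    defective-colouring : (Fin n → Fin k) → ∃ λ χ → ∀ v → same χ v (χ v) ≤ t
    defective-colouring χ₀ = improve (suc (energy χ₀)) χ₀ ≤-refl
      where
      improve : ∀ bound χ → energy χ < bound → ∃ λ χ → ∀ v → same χ v (χ v) ≤ t
      improve (suc bound) χ (s≤s l) with Fin.all? (λ v → same χ v (χ v) ≤? t)
      ... | yes good = χ , good
      ... | no  bad  with v , v-bad ← Fin.¬∀⟶∃¬ n _ (λ v → same χ v (χ v) ≤? t) bad
                     with c , c-sparse ← sparse-colour χ v =
        improve bound (recolour χ v c) (<-≤-trans (+-cancelʳ-< m₂ _ _ (begin-strict
          energy (recolour χ v c) + m₂ ≡⟨ energy-recolour χ v c ⟩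
          energy χ + (same χ v c + same χ v c) <⟨ +-monoʳ-< (energy χ) (+-mono-< better better) ⟩
          energy χ + m₂ ∎)) l)
        where
        open ≤-Reasoning
        m₂ = same χ v (χ v) + same χ v (χ v)
        better : same χ v c < same χ v (χ v)
        better = ≤-<-trans c-sparse (≰⇒> v-bad)

degreeCount : ∀ {n} → Graph n → ℕ → ℕ
degreeCount G i = ∑ (λ v → 𝟙 (degree G v ≟ i))

module _ {n : ℕ} (G : Graph n) where

  open DartSum G

  degreeCount≤ : ∀ i k → 1 ≤ k → i < k * 3 → degreeCount G i ≤ k * α-reg 2 G
  degreeCount≤ i (suc k) _ i<3k = begin
    degreeCount G i                                                ≡⟨ ∑-cong by-colour ⟩
    ∑ (λ v → ∑ (λ c → 𝟙 ((degree G v ≟ i) ×-dec (c Fin.≟ χ v))))  ≡⟨ ∑-comm _ ⟩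
    ∑ (λ c → ∑ (λ v → 𝟙 ((degree G v ≟ i) ×-dec (c Fin.≟ χ v))))  ≤⟨ ∑-mono colour-class ⟩
    ∑ (λ (c : Fin (suc k)) → α-reg 2 G)                            ≡⟨ ∑-const (suc k) _ ⟩
    suc k * α-reg 2 G                                              ∎
    where
    open ≤-Reasoning
    W? : ∀ v → Dec (degree G v ≡ i)
    W? v = degree G v ≟ i
    -- Only edges between two vertices of degree `i` count. All other rows vanish, so the row bound
    -- holds at every vertex.
    a : Fin n → Fin n → ℕ
    a u v = 𝟙 (edge? u v) * (𝟙 (W? u) * 𝟙 (W? v))
    a-sym : ∀ u v → a u v ≡ a v u
    a-sym u v = cong₂ _*_ (𝟙-cong (edge? u v) (edge? v u) (symm G u v) (symm G v u)) (*-comm (𝟙 (W? u)) (𝟙 (W? v)))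
    a-diag : ∀ v → a v v ≡ 0
    a-diag v = cong (_* (𝟙 (W? v) * 𝟙 (W? v))) (𝟙-no (edge? v v) (irrefl G v))
    row≤ : ∀ v → ∑ (a v) ≤ 𝟙 (W? v) * degree G v
    row≤ v = begin
      ∑ (a v)                                ≤⟨ (∑-mono λ u → entry≤ (𝟙 (edge? v u)) (𝟙 (W? v)) (𝟙≤1 (W? u))) ⟩
      ∑ (λ u → 𝟙 (W? v) * 𝟙 (edge? v u))   ≡⟨ ∑-* (𝟙 (W? v)) _ ⟩
      𝟙 (W? v) * ∑ (λ u → 𝟙 (edge? v u))   ≡⟨ cong (𝟙 (W? v) *_) (degree-∑ G v) ⟨
      𝟙 (W? v) * degree G v                 ∎
      where
      entry≤ : ∀ x y {z} → z ≤ 1 → x * (y * z) ≤ y * x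
      entry≤ x y {z} z≤1 = begin
        x * (y * z) ≤⟨ *-monoʳ-≤ x (*-monoʳ-≤ y z≤1) ⟩
        x * (y * 1) ≡⟨ swap x y ⟩
        y * x       ∎
        where
        swap : ∀ x y → x * (y * 1) ≡ y * x
        swap = solve-∀
    row-bound : ∀ v → ∑ (a v) < suc k * 3
    row-bound v = ≤-<-trans (≤-trans (row≤ v) (degree≤ (W? v))) i<3k
      where
      degree≤ : (d : Dec (degree G v ≡ i)) → 𝟙 d * degree G v ≤ i
      degree≤ (yes refl) = ≤-reflexive (+-identityʳ i)
      degree≤ (no _)     = z≤n
    open Recolour a a-sym a-diag
    -- The constant start colouring exists because there is at least one colour.
    colouring = defective-colouring 2 row-bound (λ _ → zero)
    χ = proj₁ colouring
    by-colour : ∀ v → 𝟙 (W? v) ≡ ∑ (λ c → 𝟙 (W? v ×-dec (c Fin.≟ χ v)))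
    by-colour v = sym (begin-equality
      ∑ (λ c → 𝟙 (W? v ×-dec (c Fin.≟ χ v)))   ≡⟨ (∑-cong λ c → trans (𝟙-× (W? v) (c Fin.≟ χ v)) (trans (*-comm (𝟙 (W? v)) _) (cong (_* 𝟙 (W? v)) (𝟙-cong (c Fin.≟ χ v) (χ v Fin.≟ c) sym sym)))) ⟩
      ∑ (λ c → 𝟙 (χ v Fin.≟ c) * 𝟙 (W? v))     ≡⟨ ∑-point (χ v) _ ⟩
      𝟙 (W? v)                                  ∎)
    colour-class : ∀ c → ∑ (λ v → 𝟙 (W? v ×-dec (c Fin.≟ χ v))) ≤ α-reg 2 G
    colour-class c = α-reg-≥ G (λ v → W? v ×-dec (c Fin.≟ χ v)) 2
      (λ { u v (du , _) (dv , _) → trans du (sym dv) })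
      λ { v (dv , refl) → ≤-trans (≤-reflexive (∑-cong λ u → entry v dv u)) (proj₂ colouring v) }
      where
      entry : ∀ v → degree G v ≡ i → ∀ u → 𝟙 (edge? v u) * 𝟙 (W? u ×-dec (χ v Fin.≟ χ u)) ≡ a v u * 𝟙 (χ v Fin.≟ χ u)
      entry v dv u = begin-equality
        𝟙 (edge? v u) * 𝟙 (W? u ×-dec (χ v Fin.≟ χ u))                    ≡⟨ cong (𝟙 (edge? v u) *_) (𝟙-× (W? u) (χ v Fin.≟ χ u)) ⟩
        𝟙 (edge? v u) * (𝟙 (W? u) * 𝟙 (χ v Fin.≟ χ u))                   ≡⟨ assoc (𝟙 (edge? v u)) (𝟙 (W? u)) _ ⟩
        𝟙 (edge? v u) * (1 * 𝟙 (W? u)) * 𝟙 (χ v Fin.≟ χ u)               ≡⟨ cong (λ x → 𝟙 (edge? v u) * (x * 𝟙 (W? u)) * 𝟙 (χ v Fin.≟ χ u)) (𝟙-yes (W? v) dv) ⟨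
        a v u * 𝟙 (χ v Fin.≟ χ u)                                          ∎
        where
        assoc : ∀ x y z → x * (y * z) ≡ x * (1 * y) * z
        assoc = solve-∀

-- Faces and Euler inequalities

∑-two : (f : Fin n → ℕ) {i j : Fin n} → i ≢ j → 1 ≤ f i → 1 ≤ f j → 2 ≤ ∑ f
∑-two {n} f {i} {j} i≢j li lj = begin
  2                                                        ≡⟨ cong₂ _+_ (∑-𝟙-point i) (∑-𝟙-point j) ⟨
  ∑ (λ x → 𝟙 (i Fin.≟ x)) + ∑ (λ x → 𝟙 (j Fin.≟ x))     ≡⟨ ∑-+ _ _ ⟨
  ∑ (λ x → 𝟙 (i Fin.≟ x) + 𝟙 (j Fin.≟ x))               ≤⟨ ∑-mono below ⟩
  ∑ f                                                      ∎
  where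
  open ≤-Reasoning
  below : ∀ x → 𝟙 (i Fin.≟ x) + 𝟙 (j Fin.≟ x) ≤ f x
  below x with i Fin.≟ x | j Fin.≟ x
  ... | yes refl | yes refl = contradiction refl i≢j
  ... | yes refl | no _     = li
  ... | no _     | yes refl = lj
  ... | no _     | no _     = z≤n

module _ {n : ℕ} {G : Graph n} where

  open DartSum G

  connected-closed : ∀ {ℓ} (C : Pred (Fin n) ℓ) → (∀ {u v} → C u → Adj G u v → C v) →
                     ∀ {u v} → Connected G u v → C u → C v
  connected-closed C closed ε          Cu = Cu
  connected-closed C closed (uw ◅ wv) Cu = connected-closed C closed wv (closed Cu uw)

  reverse-involutive : (d : Dart G) → reverse (reverse d) ≡ d
  reverse-involutive d = dart-≡ {reverse (reverse d)} {d} refl refl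

  source≢target : (d : Dart G) → source d ≢ target d
  source≢target (dart u .u e) refl = irrefl G u e

  leaf-dart-unique : {d e : Dart G} → degree G (source d) ≡ 1 → source d ≡ source e → d ≡ e
  leaf-dart-unique {d@(dart u v a)} {e@(dart .u w b)} leaf refl with v Fin.≟ w
  ... | yes v≡w = dart-≡ refl v≡w
  ... | no  v≢w = contradiction (≤-trans (∑-two (λ x → 𝟙 (edge? u x)) v≢w (at a) (at b)) (≤-reflexive (trans (sym (degree-∑ G u)) leaf))) λ { (s≤s ()) }
    where
    at : ∀ {x} → Adj G u x → 1 ≤ 𝟙 (edge? u x)
    at {x} uv = ≤-reflexive (sym (𝟙-yes (edge? u x) uv))

isolatedCount≡0 : {G : Graph n} → (∀ v → 1 ≤ degree G v) → isolatedCount G ≡ 0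
isolatedCount≡0 {G = G} δ≥1 = trans (length-filter-tabulate (λ v → degree G v ≟ 0) (λ v → v))
                                    (∑-zero λ v → 𝟙-no (degree G v ≟ 0) (>⇒≢ (δ≥1 v)))

module Faces {n : ℕ} {G : Graph n} (R : RotationSystem G) where

  open DartSum G

  φ : Dart G → Dart G
  φ = faceStep R

  φ-source : ∀ d → source (φ d) ≡ target d
  φ-source d = rot-source R (reverse d)

  φ-injective : ∀ {d e} → φ d ≡ φ e → d ≡ e
  φ-injective {d} {e} eq = trans (sym (reverse-involutive d)) (trans (cong reverse rev≡) (reverse-involutive e))
    where
    rev≡ : reverse d ≡ reverse e
    rev≡ = trans (sym (Inverse.strictlyInverseʳ (rotation R) _))
                 (trans (cong (Inverse.from (rotation R)) eq) (Inverse.strictlyInverseʳ (rotation R) _))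

  φ≢ : ∀ d → φ d ≢ d
  φ≢ d eq = source≢target d (trans (sym (cong source eq)) (φ-source d))

  leaf⇒rot-fixed : ∀ d → degree G (source d) ≡ 1 → rot R d ≡ d
  leaf⇒rot-fixed d leaf = sym (leaf-dart-unique leaf (sym (rot-source R d)))

  leaf⇒φ≡reverse : ∀ d → degree G (target d) ≡ 1 → φ d ≡ reverse d
  leaf⇒φ≡reverse d = leaf⇒rot-fixed (reverse d)

  -- The darts at a vertex form a single orbit of `rot`; a fixed dart is an orbit by itself and
  -- hence the only dart at its source.
  rot-fixed⇒leaf : ∀ d → rot R d ≡ d → degree G (source d) ≡ 1
  rot-fixed⇒leaf d fixed = trans (degree-∑ G v) (≤-antisym atMost atLeast)
    where
    v = source d
    stays : ∀ {e} → Orbit (rot R) d e → d ≡ e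
    stays ε               = refl
    stays (refl ◅ orbit) = stays-from orbit fixed
      where
      stays-from : ∀ {x e} → Orbit (rot R) x e → x ≡ d → d ≡ e
      stays-from ε              refl = refl
      stays-from (refl ◅ orbit) refl = stays-from orbit fixed
    target-unique : ∀ i → 1 ≤ 𝟙 (edge? v i) → target d ≡ i
    target-unique i l = cong target (stays (rot-cyclic R d (dart v i (𝟙-pos (edge? v i) l)) refl))
    atMost : ∑ (λ u → 𝟙 (edge? v u)) ≤ 1
    atMost = ∑-atMostOne _ (λ u → 𝟙≤1 (edge? v u)) λ i j li lj → trans (sym (target-unique i li)) (target-unique j lj)
    atLeast : 1 ≤ ∑ (λ u → 𝟙 (edge? v u))
    atLeast = ≤-trans (≤-reflexive (sym (𝟙-yes (edge? v (target d)) (edge d)))) (∑-term (λ u → 𝟙 (edge? v u)) (target d))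

module Components {n c : ℕ} {G : Graph n} (components : HasClassCount (Connected G) c) where

  open DartSum G

  comp : Fin n → Fin c
  comp = proj₁ components

  comp-≡ : ∀ {u v} → Connected G u v → comp u ≡ comp v
  comp-≡ = Equivalence.from (proj₂ (proj₂ components) _ _)

  connected : ∀ {u v} → comp u ≡ comp v → Connected G u v
  connected = Equivalence.to (proj₂ (proj₂ components) _ _)

  rep : Fin c → Fin n
  rep i = proj₁ (proj₁ (proj₂ components) i)

  comp-rep : ∀ i → comp (rep i) ≡ i
  comp-rep i = proj₂ (proj₁ (proj₂ components) i) refl

  -- Exceptional components are counted at their representatives, so this bounds their number by the
  -- number of components.
  repCount : ∑ (λ v → 𝟙 (rep (comp v) Fin.≟ v)) ≤ c
  repCount = begin
    ∑ (λ v → 𝟙 (rep (comp v) Fin.≟ v))           ≤⟨ (∑-mono λ v → ∑-term (λ i → 𝟙 (rep i Fin.≟ v)) (comp v)) ⟩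
    ∑ (λ v → ∑ (λ i → 𝟙 (rep i Fin.≟ v)))         ≡⟨ ∑-comm _ ⟩
    ∑ (λ i → ∑ (λ v → 𝟙 (rep i Fin.≟ v)))         ≡⟨ (∑-cong λ i → ∑-𝟙-point (rep i)) ⟩
    ∑ {c} (λ _ → 1)                                ≡⟨ trans (∑-const c 1) (*-identityʳ c) ⟩
    c                                              ∎
    where open ≤-Reasoning

module Plane {n f c : ℕ} {G : Graph n} (R : RotationSystem G)
             (faces : HasClassCount (SameFace R) f) (components : HasClassCount (Connected G) c)
             (δ≥1 : ∀ v → 1 ≤ degree G v) where

  open DartSum G
  open Faces R
  open Components {G = G} components

  face : Dart G → Fin f
  face = proj₁ faces

  face-≡ : ∀ {d e} → SameFace R d e → face d ≡ face e
  face-≡ = Equivalence.from (proj₂ (proj₂ faces) _ _)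

  face-φ : ∀ d → face (φ d) ≡ face d
  face-φ d = sym (face-≡ (refl ◅ ε))

  face-reverse : ∀ d → degree G (target d) ≡ 1 → face (reverse d) ≡ face d
  face-reverse d leaf = trans (cong face (sym (leaf⇒φ≡reverse d leaf))) (face-φ d)

  onFace : (Dart G → ℕ) → Fin f → ℕ
  onFace h j = ∑ᴰ (λ d → 𝟙 (face d Fin.≟ j) * h d)

  ∑-onFace : ∀ h → ∑ (onFace h) ≡ ∑ᴰ h
  ∑-onFace h = trans (∑ᴰ-comm _) (∑ᴰ-cong λ d → ∑-point (face d) (λ _ → h d))

  onFace-mono : ∀ {h k} → (∀ d → h d ≤ k d) → ∀ j → onFace h j ≤ onFace k j
  onFace-mono h≤k j = ∑ᴰ-mono λ d → *-monoʳ-≤ (𝟙 (face d Fin.≟ j)) (h≤k d)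

  onFace-pos : ∀ h j → 1 ≤ onFace h j → ∃ λ d → face d ≡ j × 1 ≤ h d
  onFace-pos h j l with d , l′ ← ∑ᴰ-pos _ l with l₁ , l₂ ← *-pos (𝟙 (face d Fin.≟ j)) (h d) l′ =
    d , 𝟙-pos (face d Fin.≟ j) l₁ , l₂

  onFace-term : ∀ h {j} d → face d ≡ j → 1 ≤ h d → 1 ≤ onFace h j
  onFace-term h {j} d eq l = ≤-trans
    (*-mono-≤ (≤-reflexive (sym (𝟙-yes (face d Fin.≟ j) eq))) l)
    (∑ᴰ-term (λ d → 𝟙 (face d Fin.≟ j) * h d) d)

  -- Darts are counted, so an edge with both darts on the face contributes 2.
  faceLength : Fin f → ℕ
  faceLength = onFace (λ _ → 1)

  faceLength-≥ : ∀ {j ds} → Unique ds → All (λ d → face d ≡ j) ds → length ds ≤ faceLength j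
  faceLength-≥ {j} ds! ds∈j = ∑ᴰ-unique _ ds! (All.map (λ {d} eq → ≤-reflexive (sym (trans (*-identityʳ _) (𝟙-yes (face d Fin.≟ j) eq)))) ds∈j)

  leaf? : ∀ v → Dec (degree G v ≡ 1)
  leaf? v = degree G v ≟ 1

  leaf-degree : ∀ v → 𝟙 (leaf? v) * degree G v ≡ 𝟙 (leaf? v)
  leaf-degree v = absorb (leaf? v)
    where
    absorb : (l : Dec (degree G v ≡ 1)) → 𝟙 l * degree G v ≡ 𝟙 l
    absorb (yes eq) = trans (*-identityˡ _) eq
    absorb (no _)   = refl

  -- A corner of a face is identified with the dart by which the facial walk leaves it.
  leafCorners : Fin f → ℕ
  leafCorners = onFace (λ d → 𝟙 (leaf? (source d)))

  -- The walk can turn back only at a leaf: if `φ (φ d) ≡ d`, then `φ d` is the reverse of `d`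
  -- because the graph is simple, so `rot` fixes that reverse and the target of `d` is a leaf.
  -- Otherwise `d`, `φ d` and `φ (φ d)` are distinct.
  faceLength≥3 : ∀ j → leafCorners j ≡ 0 → 3 ≤ faceLength j
  faceLength≥3 j no-leaf =
    faceLength-≥ ((φ≢ d ∘ sym ∷ d≢φφd ∷ []) ∷ (φ≢ (φ d) ∘ sym ∷ []) ∷ [] ∷ [])
                 (d∈j ∷ trans (face-φ d) d∈j ∷ trans (face-φ (φ d)) (trans (face-φ d) d∈j) ∷ [])
    where
    d = proj₁ (proj₁ (proj₂ faces) j)
    d∈j : face d ≡ j
    d∈j = proj₂ (proj₁ (proj₂ faces) j) refl
    d≢φφd : d ≢ φ (φ d)
    d≢φφd eq = contradiction no-leaf (>⇒≢ (onFace-term _ (φ d) (trans (face-φ d) d∈j)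
        (≤-reflexive (sym (𝟙-yes (leaf? (source (φ d))) leaf)))))
      where
      φd≡reverse : φ d ≡ reverse d
      φd≡reverse = dart-≡ (φ-source d) (trans (sym (φ-source (φ d))) (cong source (sym eq)))
      leaf : degree G (source (φ d)) ≡ 1
      leaf = subst (λ x → degree G x ≡ 1) (sym (φ-source d)) (rot-fixed⇒leaf (reverse d) φd≡reverse)

  lone? : (d : Dart G) → Dec (degree G (source d) ≡ 1 × degree G (target d) ≡ 1)
  lone? d = leaf? (source d) ×-dec leaf? (target d)

  -- Each component K₂ is counted at its dart that leaves the representative of the component.
  loneRep? : (d : Dart G) → Dec ((degree G (source d) ≡ 1 × degree G (target d) ≡ 1) × rep (comp (source d)) ≡ source d)
  loneRep? d = lone? d ×-dec (rep (comp (source d)) Fin.≟ source d)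

  loneCount : ℕ
  loneCount = ∑ᴰ (λ d → 𝟙 (loneRep? d))

  lone-closed : ∀ (d : Dart G) → degree G (source d) ≡ 1 → degree G (target d) ≡ 1 →
                ∀ {v} → Connected G (source d) v → v ≡ source d ⊎ v ≡ target d
  lone-closed d ls lt conn = connected-closed {G = G} (λ v → v ≡ source d ⊎ v ≡ target d) closed conn (inj₁ refl)
    where
    closed : ∀ {u v} → u ≡ source d ⊎ u ≡ target d → Adj G u v → v ≡ source d ⊎ v ≡ target d
    closed (inj₁ refl) uv = inj₂ (sym (cong target (leaf-dart-unique {d = d} {e = dart _ _ uv} ls refl)))
    closed (inj₂ refl) uv = inj₁ (sym (cong target (leaf-dart-unique {d = reverse d} {e = dart _ _ uv} lt refl)))

  -- This is ℓ ≥ 3 + k/2, doubled. The face of K₂ has ℓ = 2 and k = 2, so 6 + k exceeds 2ℓ by 4;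
  -- hence the coefficient of the correction term.
  face-bound : ∀ j → 6 + leafCorners j ≤ 2 * faceLength j + 4 * onFace (λ d → 𝟙 (loneRep? d)) j
  face-bound j with onFace (λ d → 𝟙 (lone? d)) j in loneEq
  -- The component is K₂. Both of its darts lie on this face, so the one at the representative does
  -- too and supplies the correction.
  ... | suc _ with d , d∈j , l ← onFace-pos _ j (subst (1 ≤_) (sym loneEq) (s≤s z≤n))
              with ls , lt ← 𝟙-pos (lone? d) l = begin
    6 + leafCorners j                  ≤⟨ +-monoʳ-≤ 6 (onFace-mono (λ d → 𝟙≤1 (leaf? (source d))) j) ⟩
    6 + faceLength j                   ≡⟨ rearrange (faceLength j) ⟩
    2 + (faceLength j) + 4 * 1         ≤⟨ +-mono-≤ (+-monoˡ-≤ (faceLength j) two) (*-monoʳ-≤ 4 rep-on-face) ⟩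
    faceLength j + faceLength j + 4 * κ ≡⟨ double (faceLength j) κ ⟩
    2 * faceLength j + 4 * κ           ∎
    where
    open ≤-Reasoning
    κ = onFace (λ d → 𝟙 (loneRep? d)) j
    rearrange : ∀ x → 6 + x ≡ 2 + x + 4 * 1
    rearrange = solve-∀
    double : ∀ x y → x + x + 4 * y ≡ 2 * x + 4 * y
    double = solve-∀
    reverse∈j : face (reverse d) ≡ j
    reverse∈j = trans (face-reverse d lt) d∈j
    two : 2 ≤ faceLength j
    two = faceLength-≥ ((source≢target d ∘ cong source ∷ []) ∷ [] ∷ []) (d∈j ∷ reverse∈j ∷ [])
    rep-on-face : 1 ≤ κ
    rep-on-face with lone-closed d ls lt (connected (sym (comp-rep (comp (source d)))))
    ... | inj₁ eq = onFace-term _ d d∈j (≤-reflexive (sym (𝟙-yes (loneRep? d) ((ls , lt) , eq))))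
    ... | inj₂ eq = onFace-term _ (reverse d) reverse∈j (≤-reflexive (sym (𝟙-yes (loneRep? (reverse d))
                      ((lt , ls) , trans (cong rep (sym (comp-≡ (edge d ◅ ε)))) eq))))
  ... | zero = begin
    6 + leafCorners j                  ≤⟨ halve (leafCorners j) (faceLength j) two-corners enough ⟩
    2 * faceLength j                   ≤⟨ m≤m+n _ _ ⟩
    2 * faceLength j + 4 * κ           ∎
    where
    open ≤-Reasoning
    κ = onFace (λ d → 𝟙 (loneRep? d)) j
    -- If ℓ ≥ 4, then 2k ≤ ℓ and 12 ≤ 3ℓ add up to twice the claim.
    halve : ∀ k ℓ → k + k ≤ ℓ → (k ≡ 0 × 3 ≤ ℓ) ⊎ 4 ≤ ℓ → 6 + k ≤ 2 * ℓ
    halve k ℓ kk≤ℓ (inj₁ (refl , 3≤ℓ)) = *-monoʳ-≤ 2 3≤ℓ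
    halve k ℓ kk≤ℓ (inj₂ 4≤ℓ) = *-cancelˡ-≤ 2 (begin
      2 * (6 + k)         ≡⟨ rearrange k ⟩
      (k + k) + 3 * 4     ≤⟨ +-mono-≤ kk≤ℓ (*-monoʳ-≤ 3 4≤ℓ) ⟩
      ℓ + 3 * ℓ           ≡⟨ collect ℓ ⟩
      2 * (2 * ℓ)         ∎)
      where
      rearrange : ∀ k → 2 * (6 + k) ≡ (k + k) + 3 * 4
      rearrange = solve-∀
      collect : ∀ ℓ → ℓ + 3 * ℓ ≡ 2 * (2 * ℓ)
      collect = solve-∀
    not-lone : ∀ d → face d ≡ j → ¬ (degree G (source d) ≡ 1 × degree G (target d) ≡ 1)
    not-lone d d∈j lone = contradiction loneEq (>⇒≢ (onFace-term _ d d∈j (≤-reflexive (sym (𝟙-yes (lone? d) lone)))))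
    -- At a leaf the walk turns back, so both darts of the leaf edge lie on the face. Different leaf
    -- corners use different edges, since no edge on this face joins two leaves.
    two-corners : leafCorners j + leafCorners j ≤ faceLength j
    two-corners = begin
      leafCorners j + leafCorners j                    ≡⟨ cong (leafCorners j +_) (∑ᴰ-reverse _) ⟨
      leafCorners j + ∑ᴰ (λ d → out (reverse d))       ≡⟨ ∑ᴰ-+ _ _ ⟨
      ∑ᴰ (λ d → out d + out (reverse d))               ≤⟨ ∑ᴰ-mono pointwise ⟩
      faceLength j                                     ∎
      where
      out : Dart G → ℕ
      out d = 𝟙 (face d Fin.≟ j) * 𝟙 (leaf? (source d))
      pointwise : ∀ d → out d + out (reverse d) ≤ 𝟙 (face d Fin.≟ j) * 1
      pointwise d = case leaf? (target d) of λ
        { (yes lt) → begin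
            out d + out (reverse d)  ≡⟨ cong (λ x → out d + 𝟙 (x Fin.≟ j) * 𝟙 (leaf? (target d))) (face-reverse d lt) ⟩
            out d + 𝟙 (face d Fin.≟ j) * 𝟙 (leaf? (target d)) ≡⟨ *-distribˡ-+ (𝟙 (face d Fin.≟ j)) _ _ ⟨
            𝟙 (face d Fin.≟ j) * (𝟙 (leaf? (source d)) + 𝟙 (leaf? (target d))) ≤⟨ at-most-one d ⟩
            𝟙 (face d Fin.≟ j) * 1 ∎
        ; (no ¬lt) → begin
            out d + out (reverse d)  ≡⟨ cong (λ x → out d + 𝟙 (face (reverse d) Fin.≟ j) * x) (𝟙-no (leaf? (target d)) ¬lt) ⟩
            out d + 𝟙 (face (reverse d) Fin.≟ j) * 0 ≡⟨ trans (cong (out d +_) (*-zeroʳ (𝟙 (face (reverse d) Fin.≟ j)))) (+-identityʳ _) ⟩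
            out d                    ≤⟨ *-monoʳ-≤ (𝟙 (face d Fin.≟ j)) (𝟙≤1 (leaf? (source d))) ⟩
            𝟙 (face d Fin.≟ j) * 1  ∎
        }
        where
        at-most-one : ∀ d → 𝟙 (face d Fin.≟ j) * (𝟙 (leaf? (source d)) + 𝟙 (leaf? (target d))) ≤ 𝟙 (face d Fin.≟ j) * 1
        at-most-one d with face d Fin.≟ j
        ... | no _    = z≤n
        ... | yes d∈j = *-monoʳ-≤ 1 (𝟙-exclusive (leaf? (source d)) (leaf? (target d)) (not-lone d d∈j))
    -- If the dart `d` leaves a leaf, then `reverse d`, `d`, `φ d`, `φ (φ d)` are consecutive on the
    -- walk. A coincidence among them would produce a loop or make the other end of `d` a leaf as
    -- well.
    enough : (leafCorners j ≡ 0 × 3 ≤ faceLength j) ⊎ 4 ≤ faceLength j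
    enough with leafCorners j in leafEq
    ... | zero  = inj₁ (refl , faceLength≥3 j leafEq)
    ... | suc _ with d , d∈j , l ← onFace-pos _ j (subst (1 ≤_) (sym leafEq) (s≤s z≤n)) = inj₂
      (faceLength-≥ ((source≢target d ∘ sym ∘ cong source ∷ r≢φd ∷ r≢φφd ∷ []) ∷ (φ≢ d ∘ sym ∷ d≢φφd ∷ []) ∷ (φ≢ (φ d) ∘ sym ∷ []) ∷ [] ∷ [])
                    (trans r∈ d∈j ∷ d∈j ∷ trans (face-φ d) d∈j ∷ trans (face-φ (φ d)) (trans (face-φ d) d∈j) ∷ []))
      where
      leaf = 𝟙-pos (leaf? (source d)) l
      r = reverse d
      φr≡d : φ r ≡ d
      φr≡d = trans (leaf⇒φ≡reverse r leaf) (reverse-involutive d)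
      r∈ : face r ≡ face d
      r∈ = trans (sym (face-φ r)) (cong face φr≡d)
      r≢φd : r ≢ φ d
      r≢φd eq = not-lone d d∈j (leaf , rot-fixed⇒leaf r (sym eq))
      d≢φφd : d ≢ φ (φ d)
      d≢φφd eq = r≢φd (φ-injective (trans φr≡d eq))
      r≢φφd : r ≢ φ (φ d)
      r≢φφd eq = source≢target (φ d) (trans (φ-source d) (trans (cong source eq) (φ-source (φ d))))

  -- Forgetting the condition on the target leaves the leaves that represent their component, each
  -- with a single dart.
  loneCount≤c : loneCount ≤ c
  loneCount≤c = begin
    ∑ᴰ (λ d → 𝟙 (loneRep? d))                    ≤⟨ ∑ᴰ-mono forget ⟩
    ∑ᴰ (leafRep ∘ source)                        ≡⟨ ∑ᴰ-degree G leafRep ⟩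
    ∑ (λ v → leafRep v * degree G v)             ≤⟨ ∑-mono once ⟩
    ∑ (λ v → 𝟙 (rep (comp v) Fin.≟ v))           ≤⟨ repCount ⟩
    c                                            ∎
    where
    open ≤-Reasoning
    leafRep : Fin n → ℕ
    leafRep v = 𝟙 (leaf? v ×-dec (rep (comp v) Fin.≟ v))
    forget : ∀ d → 𝟙 (loneRep? d) ≤ leafRep (source d)
    forget d = 𝟙-mono (loneRep? d) (leaf? (source d) ×-dec (rep (comp (source d)) Fin.≟ source d)) λ ((l , _) , r) → l , r
    once : ∀ v → leafRep v * degree G v ≤ 𝟙 (rep (comp v) Fin.≟ v)
    once v = begin
      leafRep v * degree G v                                             ≡⟨ cong (_* degree G v) (𝟙-× (leaf? v) (rep (comp v) Fin.≟ v)) ⟩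
      𝟙 (leaf? v) * 𝟙 (rep (comp v) Fin.≟ v) * degree G v              ≡⟨ swap (𝟙 (leaf? v)) _ _ ⟩
      𝟙 (leaf? v) * degree G v * 𝟙 (rep (comp v) Fin.≟ v)              ≡⟨ cong (_* 𝟙 (rep (comp v) Fin.≟ v)) (leaf-degree v) ⟩
      𝟙 (leaf? v) * 𝟙 (rep (comp v) Fin.≟ v)                            ≤⟨ *-monoˡ-≤ _ (𝟙≤1 (leaf? v)) ⟩
      1 * 𝟙 (rep (comp v) Fin.≟ v)                                       ≡⟨ *-identityˡ _ ⟩
      𝟙 (rep (comp v) Fin.≟ v)                                           ∎
      where
      swap : ∀ x y z → x * y * z ≡ x * z * y
      swap = solve-∀

  module _ (euler : n + (f + isolatedCount G) ≡ edgeCount G + 2 * c) where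

    private
      E : ℕ
      E = edgeCount G

    euler′ : n + f ≡ E + 2 * c
    euler′ = trans (cong (n +_) (trans (sym (+-identityʳ f)) (cong (f +_) (sym (isolatedCount≡0 {G = G} δ≥1))))) euler

    -- Six times Euler's formula combined with the sum of `face-bound` over all faces: lengths add
    -- up to `2 * E`, and every leaf has exactly one corner.
    planar-bound : 2 * E + 12 * c + degreeCount G 1 ≤ 6 * n + 4 * loneCount
    planar-bound = +-cancelʳ-≤ (4 * E + 6 * f) _ _ (begin
      2 * E + 12 * c + degreeCount G 1 + (4 * E + 6 * f)   ≡⟨ arrange₁ E c f (degreeCount G 1) ⟩
      6 * (E + 2 * c) + (f * 6 + degreeCount G 1)          ≤⟨ +-mono-≤ (≤-reflexive (cong (6 *_) (sym euler′))) corners ⟩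
      6 * (n + f) + (2 * (2 * E) + 4 * loneCount)          ≡⟨ arrange₂ E n f loneCount ⟩
      6 * n + 4 * loneCount + (4 * E + 6 * f)              ∎)
      where
      open ≤-Reasoning
      arrange₁ : ∀ E c f x → 2 * E + 12 * c + x + (4 * E + 6 * f) ≡ 6 * (E + 2 * c) + (f * 6 + x)
      arrange₁ = solve-∀
      arrange₂ : ∀ E n f k → 6 * (n + f) + (2 * (2 * E) + 4 * k) ≡ 6 * n + 4 * k + (4 * E + 6 * f)
      arrange₂ = solve-∀
      leaf-darts : ∑ leafCorners ≡ degreeCount G 1
      leaf-darts = trans (∑-onFace _) (trans (∑ᴰ-degree G (λ v → 𝟙 (leaf? v))) (∑-cong leaf-degree))
      corners : f * 6 + degreeCount G 1 ≤ 2 * (2 * E) + 4 * loneCount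
      corners = begin
        f * 6 + degreeCount G 1                    ≡⟨ cong₂ _+_ (∑-const f 6) leaf-darts ⟨
        ∑ {f} (λ _ → 6) + ∑ leafCorners            ≡⟨ ∑-+ _ _ ⟨
        ∑ (λ j → 6 + leafCorners j)                ≤⟨ ∑-mono face-bound ⟩
        ∑ (λ j → 2 * faceLength j + 4 * κ j)       ≡⟨ ∑-+ _ _ ⟩
        ∑ (λ j → 2 * faceLength j) + ∑ (λ j → 4 * κ j) ≡⟨ cong₂ _+_ (∑-* 2 _) (∑-* 4 _) ⟩
        2 * ∑ faceLength + 4 * ∑ κ                 ≡⟨ cong₂ (λ x y → 2 * x + 4 * y) (trans (∑-onFace _) (trans (∑ᴰ-1 G) (handshake G))) (∑-onFace _) ⟩
        2 * (2 * E) + 4 * loneCount                ∎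
        where
        κ = onFace (λ d → 𝟙 (loneRep? d))

    -- Each vertex picks one dart on the outer face of its component. A face that is outer for no
    -- component carries no picked dart and has length at least 3. An outer face has at most as many
    -- picked darts as its length, and its 3 is charged to the component. Summing over the faces
    -- gives 3f + n ≤ 2E + 3c.
    outerplanar-bound : (∀ v → 2 ≤ degree G v) → HasOuterFaces R → E + 3 * c ≤ 2 * n
    outerplanar-bound δ≥2 hasOuter = +-cancelʳ-≤ (2 * E + 3 * c) _ _ (begin
      E + 3 * c + (2 * E + 3 * c)  ≡⟨ arrange₁ E c ⟩
      3 * (E + 2 * c)              ≡⟨ cong (3 *_) euler′ ⟨
      3 * (n + f)                  ≡⟨ arrange₂ n f ⟩
      2 * n + (f * 3 + n)          ≤⟨ +-monoʳ-≤ (2 * n) lengths ⟩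
      2 * n + (2 * E + 3 * c)      ∎)
      where
      open ≤-Reasoning
      arrange₁ : ∀ E c → E + 3 * c + (2 * E + 3 * c) ≡ 3 * (E + 2 * c)
      arrange₁ = solve-∀
      arrange₂ : ∀ n f → 3 * (n + f) ≡ 2 * n + (f * 3 + n)
      arrange₂ = solve-∀
      outer : ∀ i → ∃ λ d → ∀ v → Connected G (rep i) v → ∃ λ e → source e ≡ v × SameFace R d e
      outer i = hasOuter (rep i) (>⇒≢ (δ≥1 (rep i)))
      outerFace : Fin c → Fin f
      outerFace i = face (proj₁ (outer i))
      corner : ∀ v → ∃ λ e → source e ≡ v × SameFace R (proj₁ (outer (comp v))) e
      corner v = proj₂ (outer (comp v)) v (connected (comp-rep (comp v)))
      outDart : Fin n → Dart G
      outDart v = proj₁ (corner v)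
      outDart-source : ∀ v → source (outDart v) ≡ v
      outDart-source v = proj₁ (proj₂ (corner v))
      isOut : Dart G → ℕ
      isOut d = 𝟙 (outDart (source d) ≟ᴰ d)
      outerFaces : Fin f → ℕ
      outerFaces j = ∑ (λ i → 𝟙 (outerFace i Fin.≟ j))
      no-leaf : ∀ j → leafCorners j ≡ 0
      no-leaf j with leafCorners j in eq
      ... | zero  = refl
      ... | suc _ with d , _ , l ← onFace-pos _ j (subst (1 ≤_) (sym eq) (s≤s z≤n)) =
        contradiction (𝟙-pos (leaf? (source d)) l) (>⇒≢ (δ≥2 (source d)))
      face-outer : ∀ j → 3 + onFace isOut j ≤ faceLength j + 3 * outerFaces j
      face-outer j with outerFaces j in eq
      ... | suc b = begin
        3 + onFace isOut j           ≤⟨ +-monoʳ-≤ 3 (onFace-mono (λ d → 𝟙≤1 (outDart (source d) ≟ᴰ d)) j) ⟩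
        3 + faceLength j             ≡⟨ +-comm 3 (faceLength j) ⟩
        faceLength j + 3 * 1         ≤⟨ +-monoʳ-≤ (faceLength j) (*-monoʳ-≤ 3 (s≤s z≤n)) ⟩
        faceLength j + 3 * suc b     ∎
      ... | zero with onFace isOut j in eq′
      ...   | zero  = ≤-trans (faceLength≥3 j (no-leaf j)) (m≤m+n _ _)
      ...   | suc _ with d , d∈j , l ← onFace-pos _ j (subst (1 ≤_) (sym eq′) (s≤s z≤n)) =
        contradiction eq (>⇒≢ (≤-trans (≤-reflexive (sym (𝟙-yes (outerFace (comp (source d)) Fin.≟ j) outer∈j)))
                                        (∑-term (λ i → 𝟙 (outerFace i Fin.≟ j)) (comp (source d)))))
        where
        outer∈j : outerFace (comp (source d)) ≡ j
        outer∈j = trans (face-≡ (proj₂ (proj₂ (corner (source d)))))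
                        (trans (cong face (𝟙-pos (outDart (source d) ≟ᴰ d) l)) d∈j)
      n≤outDarts : n ≤ ∑ᴰ isOut
      n≤outDarts = begin
        n                                       ≡⟨ trans (List.length-map outDart (allFin n)) (List.length-tabulate (λ v → v)) ⟨
        length (List.map outDart (allFin n))    ≤⟨ ∑ᴰ-unique isOut (map⁺ outDart-injective (allFin⁺ n)) (All.map⁺ (All.tabulate λ {v} _ → isOut-outDart v)) ⟩
        ∑ᴰ isOut                                ∎
        where
        outDart-injective : ∀ {u v} → outDart u ≡ outDart v → u ≡ v
        outDart-injective {u} {v} eq = trans (sym (outDart-source u)) (trans (cong source eq) (outDart-source v))
        isOut-outDart : ∀ v → 1 ≤ isOut (outDart v)
        isOut-outDart v = ≤-reflexive (sym (𝟙-yes (outDart (source (outDart v)) ≟ᴰ outDart v) (cong outDart (outDart-source v))))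
      lengths : f * 3 + n ≤ 2 * E + 3 * c
      lengths = begin
        f * 3 + n                                      ≤⟨ +-monoʳ-≤ (f * 3) n≤outDarts ⟩
        f * 3 + ∑ᴰ isOut                               ≡⟨ cong₂ _+_ (∑-const f 3) (∑-onFace isOut) ⟨
        ∑ {f} (λ _ → 3) + ∑ (onFace isOut)             ≡⟨ ∑-+ _ _ ⟨
        ∑ (λ j → 3 + onFace isOut j)                   ≤⟨ ∑-mono face-outer ⟩
        ∑ (λ j → faceLength j + 3 * outerFaces j)      ≡⟨ trans (∑-+ _ _) (cong (∑ faceLength +_) (∑-* 3 _)) ⟩
        ∑ faceLength + 3 * ∑ outerFaces                ≡⟨ cong₂ (λ x y → x + 3 * y) (trans (∑-onFace _) (trans (∑ᴰ-1 G) (handshake G))) ∑-outerFaces ⟩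
        2 * E + 3 * c                                  ∎
        where
        ∑-outerFaces : ∑ outerFaces ≡ c
        ∑-outerFaces = begin-equality
          ∑ outerFaces                                   ≡⟨ ∑-comm _ ⟩
          ∑ (λ i → ∑ (λ j → 𝟙 (outerFace i Fin.≟ j)))  ≡⟨ (∑-cong λ i → ∑-𝟙-point (outerFace i)) ⟩
          ∑ {c} (λ _ → 1)                                ≡⟨ trans (∑-const c 1) (*-identityʳ c) ⟩
          c                                              ∎

-- Adding an edge inside a face

𝟙-⊎ : ∀ {p q r} {P : Set p} {Q : Set q} {R : Set r} (P? : Dec P) (Q? : Dec Q) (R? : Dec R) →
      (R → P ⊎ Q) → (P → R) → (Q → R) → ¬ (P × Q) → 𝟙 R? ≡ 𝟙 P? + 𝟙 Q?
𝟙-⊎ (yes x) (yes y) R? split left right disjoint = contradiction (x , y) disjoint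
𝟙-⊎ (yes x) (no _)  R? split left right disjoint = 𝟙-yes R? (left x)
𝟙-⊎ (no _)  (yes y) R? split left right disjoint = 𝟙-yes R? (right y)
𝟙-⊎ (no ¬x) (no ¬y) R? split left right disjoint = 𝟙-no R? λ r → [ ¬x , ¬y ]′ (split r)

orbit-invariant : {A B : Set} {f : A → A} (κ : A → B) → (∀ x → κ (f x) ≡ κ x) → ∀ {x y} → Orbit f x y → κ x ≡ κ y
orbit-invariant κ inv ε              = refl
orbit-invariant κ inv (refl ◅ orbit) = trans (sym (inv _)) (orbit-invariant κ inv orbit)

-- The darts `A` from `x` to `v` and `C` from `v` to `z` are consecutive on a face, and the new edge
-- joins `x` to `z` across this corner.
module AddChord {n : ℕ} {G : Graph n} (R : RotationSystem G) (A C : Dart G) (corner : faceStep R A ≡ C)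
                (x≢z : source A ≢ target C) (¬xz : ¬ Adj G (source A) (target C)) where

  open DartSum G
  open Faces R

  x v z : Fin n
  x = source A
  v = source C
  z = target C

  v≡ : v ≡ target A
  v≡ = trans (cong source (sym corner)) (φ-source A)

  New : Fin n → Fin n → Set
  New u w = (x ≡ u × z ≡ w) ⊎ (z ≡ u × x ≡ w)

  new? : ∀ u w → Dec (New u w)
  new? u w = ((x Fin.≟ u) ×-dec (z Fin.≟ w)) ⊎-dec ((z Fin.≟ u) ×-dec (x Fin.≟ w))

  New-sym : ∀ {u w} → New u w → New w u
  New-sym (inj₁ (p , q)) = inj₂ (q , p)
  New-sym (inj₂ (p , q)) = inj₁ (q , p)

  New⇒¬Adj : ∀ {u w} → New u w → ¬ Adj G u w
  New⇒¬Adj (inj₁ (refl , refl)) = ¬xz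
  New⇒¬Adj (inj₂ (refl , refl)) = ¬xz ∘ symm G z x

  HAdj⇒ : ∀ u w → T (adj G u w ∨ ⌊ new? u w ⌋) → Adj G u w ⊎ New u w
  HAdj⇒ u w = Sum.map₂ (toWitness {a? = new? u w}) ∘ Equivalence.to (T-∨ {x = adj G u w})

  HAdj⇐ : ∀ u w → Adj G u w ⊎ New u w → T (adj G u w ∨ ⌊ new? u w ⌋)
  HAdj⇐ u w = Equivalence.from (T-∨ {x = adj G u w}) ∘ Sum.map₂ (fromWitness {a? = new? u w})

  H : Graph n
  H = record
    { adj    = λ u w → adj G u w ∨ ⌊ new? u w ⌋
    ; symm   = λ u w → HAdj⇐ w u ∘ Sum.map (symm G u w) New-sym ∘ HAdj⇒ u w
    ; irrefl = λ u → [ irrefl G u , [ (λ (p , q) → x≢z (trans p (sym q))) , (λ (p , q) → x≢z (trans q (sym p))) ]′ ]′ ∘ HAdj⇒ u u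
    }

  -- A dart of `H` carries a proof of a Boolean disjunction, which is awkward to split on. Rotation
  -- and faces are therefore defined by cases on this copy and transported along `toH` and `fromH`.
  data Dart⁺ : Set where
    old   : Dart G → Dart⁺
    xz zx : Dart⁺

  source⁺ target⁺ : Dart⁺ → Fin n
  source⁺ (old d) = source d
  source⁺ xz      = x
  source⁺ zx      = z
  target⁺ (old d) = target d
  target⁺ xz      = z
  target⁺ zx      = x

  dart⁺-≡ : ∀ d e → source⁺ d ≡ source⁺ e → target⁺ d ≡ target⁺ e → d ≡ e
  dart⁺-≡ (old d) (old e) p q = cong old (dart-≡ p q)
  dart⁺-≡ (old d) xz      p q = contradiction (edge d) (New⇒¬Adj (inj₁ (sym p , sym q)))
  dart⁺-≡ (old d) zx      p q = contradiction (edge d) (New⇒¬Adj (inj₂ (sym p , sym q)))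
  dart⁺-≡ xz      (old e) p q = contradiction (edge e) (New⇒¬Adj (inj₁ (p , q)))
  dart⁺-≡ zx      (old e) p q = contradiction (edge e) (New⇒¬Adj (inj₂ (p , q)))
  dart⁺-≡ xz      xz      p q = refl
  dart⁺-≡ xz      zx      p q = contradiction p x≢z
  dart⁺-≡ zx      xz      p q = contradiction q x≢z
  dart⁺-≡ zx      zx      p q = refl

  opaque
    toH : Dart⁺ → Dart H
    toH (old d) = dart _ _ (HAdj⇐ _ _ (inj₁ (edge d)))
    toH xz      = dart _ _ (HAdj⇐ x z (inj₂ (inj₁ (refl , refl))))
    toH zx      = dart _ _ (HAdj⇐ z x (inj₂ (inj₂ (refl , refl))))

    toH-source : ∀ d → source (toH d) ≡ source⁺ d
    toH-source (old d) = refl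
    toH-source xz      = refl
    toH-source zx      = refl

    toH-target : ∀ d → target (toH d) ≡ target⁺ d
    toH-target (old d) = refl
    toH-target xz      = refl
    toH-target zx      = refl

    fromEdge : ∀ u w → Adj G u w ⊎ New u w → ∃[ d ] (source⁺ d ≡ u × target⁺ d ≡ w)
    fromEdge u w (inj₁ e)                = old (dart u w e) , refl , refl
    fromEdge u w (inj₂ (inj₁ (p , q))) = xz , p , q
    fromEdge u w (inj₂ (inj₂ (p , q))) = zx , p , q

    fromH : Dart H → Dart⁺
    fromH (dart u w e) = proj₁ (fromEdge u w (HAdj⇒ u w e))

    fromH-source : ∀ h → source⁺ (fromH h) ≡ source h
    fromH-source (dart u w e) = proj₁ (proj₂ (fromEdge u w (HAdj⇒ u w e)))

    fromH-target : ∀ h → target⁺ (fromH h) ≡ target h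
    fromH-target (dart u w e) = proj₂ (proj₂ (fromEdge u w (HAdj⇒ u w e)))

  toH-fromH : ∀ h → toH (fromH h) ≡ h
  toH-fromH h = DartSum.dart-≡ H (trans (toH-source (fromH h)) (fromH-source h)) (trans (toH-target (fromH h)) (fromH-target h))

  fromH-toH : ∀ d → fromH (toH d) ≡ d
  fromH-toH d = dart⁺-≡ _ _ (trans (fromH-source (toH d)) (toH-source d)) (trans (fromH-target (toH d)) (toH-target d))

  reverse⁺ : Dart⁺ → Dart⁺
  reverse⁺ (old d) = old (reverse d)
  reverse⁺ xz      = zx
  reverse⁺ zx      = xz

  fromH-reverse : ∀ h → fromH (reverse h) ≡ reverse⁺ (fromH h)
  fromH-reverse h = dart⁺-≡ _ _ (trans (fromH-source (reverse h)) (trans (sym (fromH-target h)) (s (fromH h))))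
                                (trans (fromH-target (reverse h)) (trans (sym (fromH-source h)) (t (fromH h))))
    where
    s : ∀ d → target⁺ d ≡ source⁺ (reverse⁺ d)
    s (old d) = refl
    s xz      = refl
    s zx      = refl
    t : ∀ d → source⁺ d ≡ target⁺ (reverse⁺ d)
    t (old d) = refl
    t xz      = refl
    t zx      = refl

  B : Dart G
  B = φ C

  B-source : source B ≡ z
  B-source = φ-source C

  rot⁻¹ : Dart G → Dart G
  rot⁻¹ = Inverse.from (rotation R)

  rot-rot⁻¹ : ∀ d → rot R (rot⁻¹ d) ≡ d
  rot-rot⁻¹ = Inverse.strictlyInverseˡ (rotation R)

  rot⁻¹-rot : ∀ d → rot⁻¹ (rot R d) ≡ d
  rot⁻¹-rot = Inverse.strictlyInverseʳ (rotation R)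

  A≢B : A ≢ B
  A≢B eq = x≢z (trans (cong source eq) B-source)

  A≢C : A ≢ C
  A≢C eq = φ≢ A (trans corner (sym eq))

  B≢C : B ≢ C
  B≢C = φ≢ C

  -- The new darts xz and zx are inserted immediately before A and B in the rotations at x and z.
  pre? : ∀ d → Dec (d ≡ A) → Dec (d ≡ B) → Dart⁺
  pre? d (yes _) _       = xz
  pre? d (no _)  (yes _) = zx
  pre? d (no _)  (no _)  = old d

  pre : Dart G → Dart⁺
  pre d = pre? d (d ≟ᴰ A) (d ≟ᴰ B)

  data PreView (d : Dart G) : Set where
    isA   : d ≡ A → pre d ≡ xz → PreView d
    isB   : d ≡ B → pre d ≡ zx → PreView d
    other : d ≢ A → d ≢ B → pre d ≡ old d → PreView d

  pre-view : ∀ d → PreView d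
  pre-view d = view (d ≟ᴰ A) (d ≟ᴰ B) refl
    where
    view : (a : Dec (d ≡ A)) (b : Dec (d ≡ B)) → pre d ≡ pre? d a b → PreView d
    view (yes d≡A) _         eq = isA d≡A eq
    view (no _)    (yes d≡B) eq = isB d≡B eq
    view (no d≢A)  (no d≢B)  eq = other d≢A d≢B eq

  pre-A : pre A ≡ xz
  pre-A with pre-view A
  ... | isA _ eq     = eq
  ... | isB eq _     = contradiction eq A≢B
  ... | other ¬A _ _ = contradiction refl ¬A

  pre-B : pre B ≡ zx
  pre-B with pre-view B
  ... | isA eq _     = contradiction (sym eq) A≢B
  ... | isB _ eq     = eq
  ... | other _ ¬B _ = contradiction refl ¬B

  pre-old : ∀ {d} → d ≢ A → d ≢ B → pre d ≡ old d
  pre-old {d} d≢A d≢B with pre-view d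
  ... | isA eq _     = contradiction eq d≢A
  ... | isB eq _     = contradiction eq d≢B
  ... | other _ _ eq = eq

  σ : Dart⁺ → Dart⁺
  σ (old d) = pre (rot R d)
  σ xz      = old A
  σ zx      = old B

  σ⁻¹ : Dart⁺ → Dart⁺
  σ⁻¹ (old d) with pre d
  ... | old e = old (rot⁻¹ e)
  ... | xz    = xz
  ... | zx    = zx
  σ⁻¹ xz      = old (rot⁻¹ A)
  σ⁻¹ zx      = old (rot⁻¹ B)

  σ⁻¹-pre : ∀ d → σ⁻¹ (pre d) ≡ old (rot⁻¹ d)
  σ⁻¹-pre d with pre-view d
  ... | isA refl eq = cong σ⁻¹ eq
  ... | isB refl eq = cong σ⁻¹ eq
  ... | other _ _ eq rewrite eq | eq = refl

  σ-σ⁻¹ : ∀ d → σ (σ⁻¹ d) ≡ d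
  σ-σ⁻¹ (old d) with pre-view d
  ... | isA refl eq rewrite eq = refl
  ... | isB refl eq rewrite eq = refl
  ... | other _ _ eq rewrite eq = trans (cong pre (rot-rot⁻¹ d)) eq
  σ-σ⁻¹ xz = trans (cong pre (rot-rot⁻¹ A)) pre-A
  σ-σ⁻¹ zx = trans (cong pre (rot-rot⁻¹ B)) pre-B

  σ⁻¹-σ : ∀ d → σ⁻¹ (σ d) ≡ d
  σ⁻¹-σ (old d) = trans (σ⁻¹-pre (rot R d)) (cong old (rot⁻¹-rot d))
  σ⁻¹-σ xz rewrite pre-A = refl
  σ⁻¹-σ zx rewrite pre-B = refl

  source-pre : ∀ d → source⁺ (pre d) ≡ source d
  source-pre d with pre-view d
  ... | isA refl eq  = cong source⁺ eq
  ... | isB refl eq  = trans (cong source⁺ eq) (sym B-source)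
  ... | other _ _ eq = cong source⁺ eq

  source-σ : ∀ d → source⁺ (σ d) ≡ source⁺ d
  source-σ (old d) = trans (source-pre (rot R d)) (rot-source R d)
  source-σ xz      = refl
  source-σ zx      = B-source

  pre-orbit : ∀ d → Orbit σ (pre d) (old d)
  pre-orbit d with pre-view d
  ... | isA refl eq  = subst (λ s → Orbit σ s (old A)) (sym eq) (refl ◅ ε)
  ... | isB refl eq  = subst (λ s → Orbit σ s (old B)) (sym eq) (refl ◅ ε)
  ... | other _ _ eq = subst (λ s → Orbit σ s (old d)) (sym eq) ε

  old-orbit : ∀ {d e} → Orbit (rot R) d e → Orbit σ (old d) (old e)
  old-orbit = kleisliStar old λ { {d} refl → refl ◅ pre-orbit (rot R d) }

  -- Every dart leads to an old dart at the same vertex and is reached from one. Between old darts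
  -- the old rotation applies, each of its steps becoming one or two steps of `σ`.
  σ-cyclic : ∀ d e → source⁺ d ≡ source⁺ e → Orbit σ d e
  σ-cyclic d e eq with leave d | enter e
    where
    leave : ∀ d → ∃[ d₁ ] (source d₁ ≡ source⁺ d × Orbit σ d (old d₁))
    leave (old d) = d , refl , ε
    leave xz      = A , refl , refl ◅ ε
    leave zx      = B , B-source , refl ◅ ε
    enter : ∀ e → ∃[ e₁ ] (source e₁ ≡ source⁺ e × Orbit σ (old e₁) e)
    enter (old e) = e , refl , ε
    enter xz      = rot⁻¹ A , trans (sym (rot-source R _)) (cong source (rot-rot⁻¹ A)) , σ-σ⁻¹ xz ◅ ε
    enter zx      = rot⁻¹ B , trans (sym (rot-source R _)) (trans (cong source (rot-rot⁻¹ B)) B-source) , σ-σ⁻¹ zx ◅ ε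
  ... | d₁ , sd , leaving | e₁ , se , entering =
    leaving ◅◅ old-orbit (rot-cyclic R d₁ e₁ (trans sd (trans eq (sym se)))) ◅◅ entering

  toH-orbit : ∀ {f : Dart⁺ → Dart⁺} {g : Dart H → Dart H} → (∀ h → g h ≡ toH (f (fromH h))) →
              ∀ {d e} → Orbit f d e → Orbit g (toH d) (toH e)
  toH-orbit {f} {g} conj = gmap toH λ { {d} refl → trans (conj (toH d)) (cong (toH ∘ f) (fromH-toH d)) }

  toH-orbit′ : ∀ {f : Dart⁺ → Dart⁺} {g : Dart H → Dart H} → (∀ h → g h ≡ toH (f (fromH h))) →
               ∀ {h k} → Orbit f (fromH h) (fromH k) → Orbit g h k
  toH-orbit′ conj {h} {k} orbit = subst₂ (Orbit _) (toH-fromH h) (toH-fromH k) (toH-orbit conj orbit)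

  R⁺ : RotationSystem H
  R⁺ = record
    { rotation   = mk↔ₛ′ (toH ∘ σ ∘ fromH) (toH ∘ σ⁻¹ ∘ fromH)
                     (λ h → trans (cong (toH ∘ σ) (fromH-toH (σ⁻¹ (fromH h)))) (trans (cong toH (σ-σ⁻¹ (fromH h))) (toH-fromH h)))
                     (λ h → trans (cong (toH ∘ σ⁻¹) (fromH-toH (σ (fromH h)))) (trans (cong toH (σ⁻¹-σ (fromH h))) (toH-fromH h)))
    ; rot-source = λ h → trans (toH-source (σ (fromH h))) (trans (source-σ (fromH h)) (fromH-source h))
    ; rot-cyclic = λ h k eq → toH-orbit′ {f = σ} (λ _ → refl)
                     (σ-cyclic (fromH h) (fromH k) (trans (fromH-source h) (trans eq (sym (fromH-source k)))))
    }

  φ⁺ : Dart⁺ → Dart⁺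
  φ⁺ = σ ∘ reverse⁺

  faceStep⁺ : ∀ h → faceStep R⁺ h ≡ toH (φ⁺ (fromH h))
  faceStep⁺ h = cong (toH ∘ σ) (fromH-reverse h)

  φ⁺-A : φ⁺ (old A) ≡ old C
  φ⁺-A = trans (cong pre corner) (pre-old (A≢C ∘ sym) (B≢C ∘ sym))

  -- The face through A and C is cut into the triangle A, C, zx and a face in which xz replaces A and C.
  cut? : ∀ d → Dec (d ≡ A ⊎ d ≡ C) → Dart⁺
  cut? d (yes _) = xz
  cut? d (no _)  = old d

  corner? : ∀ d → Dec (d ≡ A ⊎ d ≡ C)
  corner? d = (d ≟ᴰ A) ⊎-dec (d ≟ᴰ C)

  cut : Dart G → Dart⁺
  cut d = cut? d (corner? d)

  cut-corner : ∀ {d} → d ≡ A ⊎ d ≡ C → cut d ≡ xz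
  cut-corner {d} in-corner = go (corner? d)
    where
    go : (a : Dec (d ≡ A ⊎ d ≡ C)) → cut? d a ≡ xz
    go (yes _)  = refl
    go (no ¬in) = contradiction in-corner ¬in

  cut-old : ∀ {d} → ¬ (d ≡ A ⊎ d ≡ C) → cut d ≡ old d
  cut-old {d} ¬corner = go (corner? d)
    where
    go : (a : Dec (d ≡ A ⊎ d ≡ C)) → cut? d a ≡ old d
    go (yes in-corner) = contradiction in-corner ¬corner
    go (no _)          = refl

  cut-B : cut B ≡ old B
  cut-B = cut-old [ A≢B ∘ sym , B≢C ]′

  -- Elsewhere the walk is unchanged, except that a step to `A` becomes a step to `xz`. A step to
  -- `B` cannot occur: `φ` is injective and only `C` precedes `B`.
  φ⁺-cut : ∀ {d} → ¬ (d ≡ A ⊎ d ≡ C) → φ⁺ (old d) ≡ cut (φ d)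
  φ⁺-cut {d} ¬corner with pre-view (φ d)
  ... | isA φd≡A eq       = trans eq (sym (cut-corner (inj₁ φd≡A)))
  ... | isB φd≡B eq       = contradiction (inj₂ (φ-injective φd≡B)) ¬corner
  ... | other φd≢A _ eq = trans eq (sym (cut-old [ φd≢A , (λ φd≡C → ¬corner (inj₁ (φ-injective (trans φd≡C (sym corner))))) ]′))

  -- `cut` carries the old walk to the new one, which pauses during the step from `A` to `C`, as
  -- both become `xz`.
  cut-orbit : ∀ {d e} → SameFace R d e → Orbit φ⁺ (cut d) (cut e)
  cut-orbit = kleisliStar cut λ { {d} refl → step d (corner? d) }
    where
    step : ∀ d → Dec (d ≡ A ⊎ d ≡ C) → Orbit φ⁺ (cut d) (cut (φ d))
    step d (yes (inj₁ refl)) = subst₂ (Orbit φ⁺) (sym (cut-corner (inj₁ refl))) (sym (cut-corner (inj₂ corner))) ε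
    step d (yes (inj₂ refl)) = subst₂ (Orbit φ⁺) (sym (cut-corner (inj₂ refl))) (sym cut-B) (refl ◅ ε)
    step d (no ¬corner)      = subst (λ s → Orbit φ⁺ s (cut (φ d))) (sym (cut-old ¬corner)) (φ⁺-cut ¬corner ◅ ε)

  module FaceCount {f : ℕ} (faces : HasClassCount (SameFace R) f) where

    face : Dart G → Fin f
    face = proj₁ faces

    face-≡ : ∀ {d e} → SameFace R d e → face d ≡ face e
    face-≡ = Equivalence.from (proj₂ (proj₂ faces) _ _)

    face-C : face A ≡ face C
    face-C = face-≡ (corner ◅ ε)

    face? : ∀ d → Dec (d ≡ A ⊎ d ≡ C) → Fin (suc f)
    face? d (yes _) = zero
    face? d (no _)  = suc (face d)

    -- `zero` is the triangle; the rest of the divided face inherits the old number.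
    face⁺ : Dart⁺ → Fin (suc f)
    face⁺ (old d) = face? d (corner? d)
    face⁺ xz      = suc (face A)
    face⁺ zx      = zero

    face⁺-corner : ∀ {d} → d ≡ A ⊎ d ≡ C → face⁺ (old d) ≡ zero
    face⁺-corner {d} in-corner = go (corner? d)
      where
      go : (a : Dec (d ≡ A ⊎ d ≡ C)) → face? d a ≡ zero
      go (yes _)  = refl
      go (no ¬in) = contradiction in-corner ¬in

    face⁺-old : ∀ {d} → ¬ (d ≡ A ⊎ d ≡ C) → face⁺ (old d) ≡ suc (face d)
    face⁺-old {d} ¬corner = go (corner? d)
      where
      go : (a : Dec (d ≡ A ⊎ d ≡ C)) → face? d a ≡ suc (face d)
      go (yes in-corner) = contradiction in-corner ¬corner
      go (no _)          = refl

    face⁺-cut : ∀ d → face⁺ (cut d) ≡ suc (face d)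
    face⁺-cut d = case corner? d of λ
      { (yes (inj₁ refl)) → cong face⁺ (cut-corner (inj₁ refl))
      ; (yes (inj₂ refl)) → trans (cong face⁺ (cut-corner (inj₂ refl))) (cong suc face-C)
      ; (no ¬corner)      → trans (cong face⁺ (cut-old ¬corner)) (face⁺-old ¬corner)
      }

    φ⁺-C : φ⁺ (old C) ≡ zx
    φ⁺-C = pre-B

    -- The evidence needed for equal face numbers to imply equal faces: on the triangle, walks to
    -- and from the base point `A`; elsewhere, an old dart, so that `cut-orbit` lifts the old walk.
    data View (d : Dart⁺) : Set where
      triangle : face⁺ d ≡ zero → Orbit φ⁺ (old A) d → Orbit φ⁺ d (old A) → View d
      residual : ∀ e → d ≡ cut e → View d

    view : ∀ d → View d
    view xz      = residual A (sym (cut-corner (inj₁ refl)))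
    view zx      = triangle refl (φ⁺-A ◅ φ⁺-C ◅ ε) (refl ◅ ε)
    view (old d) = case corner? d of λ
      { (yes (inj₁ refl)) → triangle (face⁺-corner (inj₁ refl)) ε ε
      ; (yes (inj₂ refl)) → triangle (face⁺-corner (inj₂ refl)) (φ⁺-A ◅ ε) (φ⁺-C ◅ refl ◅ ε)
      ; (no ¬corner)      → residual d (sym (cut-old ¬corner))
      }

    face⁺-φ⁺ : ∀ d → face⁺ (φ⁺ d) ≡ face⁺ d
    face⁺-φ⁺ xz = trans (face⁺-old [ A≢B ∘ sym , B≢C ]′) (cong suc (sym (face-≡ (corner ◅ refl ◅ ε))))
    face⁺-φ⁺ zx = face⁺-corner (inj₁ refl)
    face⁺-φ⁺ (old d) = case corner? d of λ
      { (yes (inj₁ refl)) → trans (cong face⁺ φ⁺-A) (trans (face⁺-corner (inj₂ refl)) (sym (face⁺-corner (inj₁ refl))))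
      ; (yes (inj₂ refl)) → trans (cong face⁺ φ⁺-C) (sym (face⁺-corner (inj₂ refl)))
      ; (no ¬corner)      → trans (cong face⁺ (φ⁺-cut ¬corner)) (trans (face⁺-cut (φ d))
                              (trans (cong suc (sym (face-≡ (refl ◅ ε)))) (sym (face⁺-old ¬corner))))
      }

    faces⁺ : HasClassCount (SameFace R⁺) (suc f)
    faces⁺ = face⁺ ∘ fromH , onto , λ h k → mk⇔ (λ eq → toH-orbit′ faceStep⁺ (same (view (fromH h)) (view (fromH k)) eq))
        (orbit-invariant (face⁺ ∘ fromH) λ h → trans (cong (face⁺ ∘ fromH) (faceStep⁺ h))
           (trans (cong face⁺ (fromH-toH (φ⁺ (fromH h)))) (face⁺-φ⁺ (fromH h))))
      where
      onto : ∀ j → ∃[ h ] (∀ {k} → k ≡ h → face⁺ (fromH k) ≡ j)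
      onto zero    = toH zx , λ { refl → cong face⁺ (fromH-toH zx) }
      onto (suc j) with d , d∈j ← proj₁ (proj₂ faces) j =
        toH (cut d) , λ { refl → trans (cong face⁺ (fromH-toH (cut d))) (trans (face⁺-cut d) (cong suc (d∈j refl))) }
      same : ∀ {d e} → View d → View e → face⁺ d ≡ face⁺ e → Orbit φ⁺ d e
      same (triangle _ _ to-A)  (triangle _ from-A _)  _  = to-A ◅◅ from-A
      same (residual d refl)    (residual e refl)      eq =
        cut-orbit (Equivalence.to (proj₂ (proj₂ faces) d e) (Fin.suc-injective (trans (sym (face⁺-cut d)) (trans eq (face⁺-cut e)))))
      same (triangle z₁ _ _)    (residual e refl)      eq with () ← trans (sym z₁) (trans eq (face⁺-cut e))
      same (residual d refl)    (triangle z₁ _ _)      eq with () ← trans (sym z₁) (trans (sym eq) (face⁺-cut d))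

  connected⁺ : ∀ {u w} → Connected G u w → Connected H u w
  connected⁺ = gmap (λ u → u) (λ {u} {w} → HAdj⇐ u w ∘ inj₁)

  -- A use of the new edge is replaced by the detour through `v`.
  connected⁻ : ∀ {u w} → Connected H u w → Connected G u w
  connected⁻ = kleisliStar (λ u → u) λ {u} {w} e → path (HAdj⇒ u w e)
    where
    Av : Adj G x v
    Av = subst (Adj G x) (sym v≡) (edge A)
    path : ∀ {u w} → Adj G u w ⊎ New u w → Connected G u w
    path (inj₁ e)                      = e ◅ ε
    path (inj₂ (inj₁ (refl , refl))) = Av ◅ edge C ◅ ε
    path (inj₂ (inj₂ (refl , refl))) = symm G v z (edge C) ◅ symm G x v Av ◅ ε

  components⁺ : ∀ {c} → HasClassCount (Connected G) c → HasClassCount (Connected H) c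
  components⁺ (comp , onto , iff) = comp , onto , λ u w →
    mk⇔ (connected⁺ ∘ Equivalence.to (iff u w)) (Equivalence.from (iff u w) ∘ connected⁻)

  private
    edgeᴴ? : ∀ u w → Dec (Adj H u w)
    edgeᴴ? = DartSum.edge? H

  degree≤ : ∀ u → degree G u ≤ degree H u
  degree≤ u = begin
    degree G u                    ≡⟨ degree-∑ G u ⟩
    ∑ (λ w → 𝟙 (edge? u w))      ≤⟨ (∑-mono λ w → 𝟙-mono (edge? u w) (edgeᴴ? u w) (HAdj⇐ u w ∘ inj₁)) ⟩
    ∑ (λ w → 𝟙 (edgeᴴ? u w))     ≡⟨ degree-∑ H u ⟨
    degree H u                    ∎
    where open ≤-Reasoning

  edgeCount⁺ : edgeCount H ≡ suc (edgeCount G)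
  edgeCount⁺ = *-cancelˡ-≡ _ _ 2 (begin
    2 * edgeCount H                                         ≡⟨ handshake H ⟨
    ∑ (degree H)                                            ≡⟨ ∑-cong (degree-∑ H) ⟩
    ∑ (λ u → ∑ (λ w → 𝟙 (edgeᴴ? u w)))                     ≡⟨ (∑-cong λ u → trans (∑-cong (count u)) (trans (∑-+ (λ w → 𝟙 (edge? u w)) _) (cong₂ _+_ (sym (degree-∑ G u)) (∑-+ (one x z u) _)))) ⟩
    ∑ (λ u → degree G u + (∑ (one x z u) + ∑ (one z x u)))  ≡⟨ trans (∑-+ (degree G) _) (cong (∑ (degree G) +_) (∑-+ (λ u → ∑ (one x z u)) _)) ⟩
    ∑ (degree G) + (∑ (λ u → ∑ (one x z u)) + ∑ (λ u → ∑ (one z x u))) ≡⟨ cong₂ _+_ (handshake G) (cong₂ _+_ (one-sum x z) (one-sum z x)) ⟩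
    2 * edgeCount G + 2                                     ≡⟨ arrange (edgeCount G) ⟩
    2 * suc (edgeCount G)                                   ∎)
    where
    open ≡-Reasoning
    one : Fin n → Fin n → Fin n → Fin n → ℕ
    one a b u w = 𝟙 (a Fin.≟ u) * 𝟙 (b Fin.≟ w)
    one-sum : ∀ a b → ∑ (λ u → ∑ (one a b u)) ≡ 1
    one-sum a b = trans (∑-cong λ u → trans (∑-* (𝟙 (a Fin.≟ u)) _) (trans (cong (𝟙 (a Fin.≟ u) *_) (∑-𝟙-point b)) (*-identityʳ _))) (∑-𝟙-point a)
    arrange : ∀ E → 2 * E + 2 ≡ 2 * suc E
    arrange = solve-∀
    count : ∀ u w → 𝟙 (edgeᴴ? u w) ≡ 𝟙 (edge? u w) + (one x z u w + one z x u w)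
    count u w = begin
      𝟙 (edgeᴴ? u w)                           ≡⟨ 𝟙-⊎ (edge? u w) (new? u w) (edgeᴴ? u w) (HAdj⇒ u w) (HAdj⇐ u w ∘ inj₁) (HAdj⇐ u w ∘ inj₂) (λ (e , new) → New⇒¬Adj new e) ⟩
      𝟙 (edge? u w) + 𝟙 (new? u w)             ≡⟨ cong (𝟙 (edge? u w) +_) (𝟙-⊎ xz? zx? (new? u w) (λ s → s) inj₁ inj₂ λ ((p , _) , (q , _)) → x≢z (trans p (sym q))) ⟩
      𝟙 (edge? u w) + (𝟙 xz? + 𝟙 zx?)          ≡⟨ cong (𝟙 (edge? u w) +_) (cong₂ _+_ (𝟙-× (x Fin.≟ u) (z Fin.≟ w)) (𝟙-× (z Fin.≟ u) (x Fin.≟ w))) ⟩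
      𝟙 (edge? u w) + (one x z u w + one z x u w) ∎
      where
      xz? = (x Fin.≟ u) ×-dec (z Fin.≟ w)
      zx? = (z Fin.≟ u) ×-dec (x Fin.≟ w)

  -- Faces and edges both increase by 1 and components are unchanged, so Euler's formula persists.
  isPlane⁺ : (∀ u → 1 ≤ degree G u) → IsPlane R → IsPlane R⁺
  isPlane⁺ δ≥1 (f , c , faces , components , euler) =
    suc f , c , FaceCount.faces⁺ faces , components⁺ components , (begin
      n + (suc f + isolatedCount H)       ≡⟨ cong (λ i → n + (suc f + i)) (trans (isolated H (λ u → ≤-trans (δ≥1 u) (degree≤ u))) (sym (isolated G δ≥1))) ⟩
      n + (suc f + isolatedCount G)       ≡⟨ +-suc n _ ⟩
      suc (n + (f + isolatedCount G))     ≡⟨ cong suc euler ⟩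
      suc (edgeCount G) + 2 * c           ≡⟨ cong (_+ 2 * c) edgeCount⁺ ⟨
      edgeCount H + 2 * c                 ∎)
    where
    open ≡-Reasoning
    isolated : ∀ K → (∀ u → 1 ≤ degree K u) → isolatedCount K ≡ 0
    isolated K = isolatedCount≡0 {G = K}

-- Counting by degree

𝟙-drop : ∀ {p q r} {P : Set p} {Q : Set q} {R : Set r} (P? : Dec P) (Q? : Dec Q) (R? : Dec R) →
         (R → P) → (R → ¬ Q) → 𝟙 P? * 𝟙 Q? + 𝟙 R? ≤ 𝟙 P?
𝟙-drop (yes _) (yes y) (yes z) R⇒P R⇒¬Q = contradiction y (R⇒¬Q z)
𝟙-drop (yes _) (yes _) (no _)  R⇒P R⇒¬Q = ≤-refl
𝟙-drop (yes _) (no _)  R?      R⇒P R⇒¬Q = 𝟙≤1 R?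
𝟙-drop (no ¬x) _       (yes z) R⇒P R⇒¬Q = contradiction (R⇒P z) ¬x
𝟙-drop (no _)  _       (no _)  R⇒P R⇒¬Q = z≤n

module DegreeCounting {n : ℕ} (G : Graph n) where

  private
    a : ℕ
    a = α-reg 2 G

  -- For i ≤ d this is (i + r) ∸ d.
  weight : ℕ → ℕ → ℕ → ℕ
  weight d i zero    = 0
  weight d i (suc r) = suc r * 𝟙 (d ≟ i) + weight d (suc i) r

  weight-≥ : ∀ {d} i r → i ≤ d → i + r ≤ d + weight d i r
  weight-≥ i zero    i≤d = +-monoˡ-≤ 0 i≤d
  weight-≥ {d} i (suc r) i≤d = case d ≟ i of λ
    { (yes refl) → +-monoʳ-≤ d (≤-trans (≤-reflexive (sym (trans (cong (suc r *_) (𝟙-yes (d ≟ i) refl)) (*-identityʳ (suc r))))) (m≤m+n _ _))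
    ; (no d≢i)   → begin
        i + suc r                      ≡⟨ +-suc i r ⟩
        suc i + r                      ≤⟨ weight-≥ (suc i) r (≤∧≢⇒< i≤d (d≢i ∘ sym)) ⟩
        d + weight d (suc i) r         ≤⟨ +-monoʳ-≤ d (m≤n+m _ _) ⟩
        d + weight d i (suc r)         ∎
    }
    where open ≤-Reasoning

  weightedCount : ℕ → ℕ → ℕ
  weightedCount i zero    = 0
  weightedCount i (suc r) = suc r * degreeCount G i + weightedCount (suc i) r

  ∑-weight : ∀ i r → ∑ (λ v → weight (degree G v) i r) ≡ weightedCount i r
  ∑-weight i zero    = ∑-zero {n} λ _ → refl
  ∑-weight i (suc r) = trans (∑-+ _ _) (cong₂ _+_ (∑-* (suc r) _) (∑-weight (suc i) r))

  degree-count : ∀ i r → (∀ v → i ≤ degree G v) → (i + r) * n ≤ 2 * edgeCount G + weightedCount i r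
  degree-count i r δ≥i = begin
    (i + r) * n                                          ≡⟨ trans (*-comm (i + r) n) (sym (∑-const n (i + r))) ⟩
    ∑ {n} (λ _ → i + r)                                  ≤⟨ (∑-mono λ v → weight-≥ i r (δ≥i v)) ⟩
    ∑ (λ v → degree G v + weight (degree G v) i r)       ≡⟨ ∑-+ _ _ ⟩
    ∑ (degree G) + ∑ (λ v → weight (degree G v) i r)     ≡⟨ cong₂ _+_ (handshake G) (∑-weight i r) ⟩
    2 * edgeCount G + weightedCount i r                  ∎
    where open ≤-Reasoning

  -- The least k with i < 3k, which is the number of colours that recolouring needs in degree i.
  classes : ℕ → ℕ
  classes i = suc (i / 3)

  degreeCount≤classes : ∀ i → degreeCount G i ≤ classes i * a
  degreeCount≤classes i = degreeCount≤ G i (classes i) (s≤s z≤n) (begin-strict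
    i                       ≡⟨ m≡m%n+[m/n]*n i 3 ⟩
    i % 3 + i / 3 * 3       <⟨ +-monoˡ-< (i / 3 * 3) (m%n<n i 3) ⟩
    classes i * 3           ∎)
    where
    open ≤-Reasoning

  -- On numerals this evaluates to the constants of the theorem; for instance `coefficient 2 7` is
  -- 55 and `coefficient 4 4` is 23.
  coefficient : ℕ → ℕ → ℕ
  coefficient i zero    = 0
  coefficient i (suc r) = suc r * classes i + coefficient (suc i) r

  weightedCount≤ : ∀ i r → weightedCount i r ≤ coefficient i r * a
  weightedCount≤ i zero    = z≤n
  weightedCount≤ i (suc r) = begin
    suc r * degreeCount G i + weightedCount (suc i) r            ≤⟨ +-mono-≤ (*-monoʳ-≤ (suc r) (degreeCount≤classes i)) (weightedCount≤ (suc i) r) ⟩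
    suc r * (classes i * a) + coefficient (suc i) r * a          ≡⟨ arrange (suc r) (classes i) a (coefficient (suc i) r) ⟩
    coefficient i (suc r) * a                                    ∎
    where
    open ≤-Reasoning
    arrange : ∀ r k a x → r * (k * a) + x * a ≡ (r * k + x) * a
    arrange = solve-∀

  degree-bound : ∀ i r → (∀ v → i ≤ degree G v) → (i + r) * n ≤ 2 * edgeCount G + coefficient i r * a
  degree-bound i r δ≥i = ≤-trans (degree-count i r δ≥i) (+-monoʳ-≤ _ (weightedCount≤ i r))

  regular⇒n≤ : ∀ i → (∀ v → degree G v ≡ i) → n ≤ classes i * a
  regular⇒n≤ i regular = begin
    n                    ≡⟨ trans (sym (*-identityʳ n)) (sym (∑-const n 1)) ⟩
    ∑ {n} (λ _ → 1)      ≡⟨ (∑-cong λ v → 𝟙-yes (degree G v ≟ i) (regular v)) ⟨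
    degreeCount G i      ≤⟨ degreeCount≤classes i ⟩
    classes i * a        ∎
    where open ≤-Reasoning

-- Arithmetic of the final estimates

combine : ∀ {m n E s k l} → (6 + m) * n ≤ 2 * E + s → 2 * E + k ≤ 6 * n + l → m * n + k ≤ s + l
combine {m} {n} {E} {s} {k} {l} count euler = +-cancelʳ-≤ (6 * n + 2 * E) _ _ (begin
  m * n + k + (6 * n + 2 * E)        ≡⟨ arrange₁ m k n E ⟩
  (6 + m) * n + (2 * E + k)          ≤⟨ +-mono-≤ count euler ⟩
  2 * E + s + (6 * n + l)            ≡⟨ arrange₂ E s n l ⟩
  s + l + (6 * n + 2 * E)            ∎)
  where
  open ≤-Reasoning
  arrange₁ : ∀ m k n E → m * n + k + (6 * n + 2 * E) ≡ (6 + m) * n + (2 * E + k)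
  arrange₁ = solve-∀
  arrange₂ : ∀ E s n l → 2 * E + s + (6 * n + l) ≡ s + l + (6 * n + 2 * E)
  arrange₂ = solve-∀

-- Of the 12 units per component, 12 are reserved for the constant term of the bound, and each of
-- `L` exceptional components costs up to 5. With two components `7 * c` already covers 12; for `L`
-- and `c` both 1 the inequality fails, which forces the separate case of a single exceptional
-- component.
component-slack : ∀ {L c} → 1 ≤ c → L ≤ c → L ≡ 0 ⊎ 2 ≤ c → 12 + 5 * L ≤ 12 * c
component-slack 1≤c _   (inj₁ refl) = *-monoʳ-≤ 12 1≤c
component-slack {L} {c} 1≤c L≤c (inj₂ 2≤c)  = begin
  12 + 5 * L   ≤⟨ +-mono-≤ {12} {7 * c} (≤-trans (m≤m+n 12 2) (*-monoʳ-≤ 7 2≤c)) (*-monoʳ-≤ 5 L≤c) ⟩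
  7 * c + 5 * c ≡⟨ *-distribʳ-+ c 7 5 ⟨
  12 * c       ∎
  where open ≤-Reasoning

one-or-more : ∀ {c} → 1 ≤ c → c ≡ 1 ⊎ 2 ≤ c
one-or-more {suc zero}    _ = inj₁ refl
one-or-more {suc (suc c)} _ = inj₂ (s≤s (s≤s z≤n))

open import Data.Integer.Base using (+_)

fraction-≥ : ∀ p q m a → p * m ≤ suc q * a → (+ a ℚ./ 1) ℚ.≥ ((+ p ℚ./ suc q) ℚ.* (+ m ℚ./ 1))
fraction-≥ p q m a l = ℚ.*≤* (begin
  (+ p ℤ.* + m) ℤ.* + 1    ≡⟨ ℤ.*-identityʳ _ ⟩
  + p ℤ.* + m              ≡⟨ ℤ.pos-* p m ⟨
  + (p * m)                ≤⟨ ℤ.+≤+ l ⟩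
  + (suc q * a)            ≡⟨ cong +_ (trans (*-comm (suc q) a) (cong (a *_) (sym (*-identityʳ (suc q))))) ⟩
  + (a * (suc q * 1))      ≡⟨ ℤ.pos-* a (suc q * 1) ⟩
  + a ℤ.* + (suc q * 1)    ∎)
  where open ℤ.≤-Reasoning

-- Bounds for planar and outerplanar graphs

module PlanarBounds {n : ℕ} {G : Graph n} (v₀ : Fin n) (planar : Planar G) (δ≥1 : ∀ v → 1 ≤ degree G v) where

  private
    a E : ℕ
    a = α-reg 2 G
    E = edgeCount G
    R = proj₁ planar
    c = proj₁ (proj₂ (proj₂ planar))
    faces = proj₁ (proj₂ (proj₂ (proj₂ planar)))
    components = proj₁ (proj₂ (proj₂ (proj₂ (proj₂ planar))))
    euler = proj₂ (proj₂ (proj₂ (proj₂ (proj₂ planar))))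

  open DartSum G
  open DegreeCounting G
  open Faces R
  open Components {G = G} components
  open Plane R faces components δ≥1 using (loneRep?; loneCount; lone-closed; loneCount≤c; planar-bound; outerplanar-bound)

  n≥1 : 1 ≤ n
  n≥1 = >-nonZero⁻¹ n {{Fin.nonZeroIndex v₀}}

  c≥1 : 1 ≤ c
  c≥1 = >-nonZero⁻¹ c {{Fin.nonZeroIndex (comp v₀)}}

  connected-if-single : c ≡ 1 → ∀ u v → Connected G u v
  connected-if-single c≡1 u v = connected (single c≡1 (comp u) (comp v))
    where
    single : ∀ {c} → c ≡ 1 → (i j : Fin c) → i ≡ j
    single refl zero zero = refl

  -- If K₂ is the only component, all vertices have degree 1 and a single colour class contains
  -- them.
  lone-cases : loneCount ≡ 0 ⊎ 2 ≤ c ⊎ n ≤ a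
  lone-cases with loneCount in eq | one-or-more c≥1
  ... | zero  | _        = inj₁ refl
  ... | suc _ | inj₂ 2≤c = inj₂ (inj₁ 2≤c)
  ... | suc _ | inj₁ c≡1 with d , l ← ∑ᴰ-pos (λ d → 𝟙 (loneRep? d)) (subst (1 ≤_) (sym eq) (s≤s z≤n))
                         with (ls , lt) , _ ← 𝟙-pos (loneRep? d) l =
    inj₂ (inj₂ (≤-trans (regular⇒n≤ 1 λ w → [ (λ { refl → ls }) , (λ { refl → lt }) ]′
                           (lone-closed d ls lt (connected-if-single c≡1 (source d) w)))
                        (≤-reflexive (*-identityˡ a))))

  δ1-bound : 4 * (n + 3) ≤ 83 * a
  δ1-bound = [ general ∘ inj₁ , [ general ∘ inj₂ , tiny ]′ ]′ lone-cases
    where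
    open ≤-Reasoning
    n₁ = degreeCount G 1
    tiny : n ≤ a → 4 * (n + 3) ≤ 83 * a
    tiny n≤a = begin
      4 * (n + 3)        ≤⟨ *-monoʳ-≤ 4 (+-mono-≤ n≤a (*-monoʳ-≤ 3 (≤-trans n≥1 n≤a))) ⟩
      4 * (a + 3 * a)    ≡⟨ arrange a ⟩
      16 * a             ≤⟨ *-monoˡ-≤ a {16} {83} (m≤m+n 16 67) ⟩
      83 * a             ∎
      where
      arrange : ∀ a → 4 * (a + 3 * a) ≡ 16 * a
      arrange = solve-∀
    general : loneCount ≡ 0 ⊎ 2 ≤ c → 4 * (n + 3) ≤ 83 * a
    -- Threshold 10. The n₁ gained in `planar-bound` lowers the weight of the leaves from 9 to 8,
    -- and `coefficient 2 8` is 75, which gives 83. The correction of 4 per K₂ is rounded up to 5 to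
    -- fit `component-slack`.
    general slack = +-cancelʳ-≤ (5 * loneCount + n₁) _ _ (begin
      4 * (n + 3) + (5 * loneCount + n₁)         ≡⟨ arrange₁ n loneCount n₁ ⟩
      4 * n + (12 + 5 * loneCount + n₁)          ≤⟨ +-monoʳ-≤ (4 * n) (+-monoˡ-≤ n₁ (component-slack c≥1 loneCount≤c slack)) ⟩
      4 * n + (12 * c + n₁)                      ≤⟨ combine {4} {n} {E} (degree-count 1 9 δ≥1) (≤-trans (≤-reflexive (sym (+-assoc (2 * E) (12 * c) n₁))) (planar-bound euler)) ⟩
      9 * n₁ + weightedCount 2 8 + 4 * loneCount ≡⟨ arrange₂ n₁ (weightedCount 2 8) loneCount ⟩
      8 * n₁ + weightedCount 2 8 + (4 * loneCount + n₁) ≤⟨ +-mono-≤ (+-mono-≤ (*-monoʳ-≤ 8 (degreeCount≤classes 1)) (weightedCount≤ 2 8))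
                                                             (+-monoˡ-≤ n₁ (*-monoˡ-≤ loneCount {4} {5} (n≤1+n 4))) ⟩
      8 * (1 * a) + 75 * a + (5 * loneCount + n₁) ≡⟨ cong (_+ (5 * loneCount + n₁)) (arrange₃ a) ⟩
      83 * a + (5 * loneCount + n₁)              ∎)
      where
      arrange₁ : ∀ n L x → 4 * (n + 3) + (5 * L + x) ≡ 4 * n + (12 + 5 * L + x)
      arrange₁ = solve-∀
      arrange₂ : ∀ x y L → 9 * x + y + 4 * L ≡ 8 * x + y + (4 * L + x)
      arrange₂ = solve-∀
      arrange₃ : ∀ a → 8 * (1 * a) + 75 * a ≡ 83 * a
      arrange₃ = solve-∀

  leafless-bound : (∀ v → 2 ≤ degree G v) → 2 * E + 12 * c ≤ 6 * n + 0
  leafless-bound δ≥2 = begin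
    2 * E + 12 * c                        ≤⟨ m≤m+n _ (degreeCount G 1) ⟩
    2 * E + 12 * c + degreeCount G 1      ≤⟨ planar-bound euler ⟩
    6 * n + 4 * loneCount                 ≡⟨ cong (λ L → 6 * n + 4 * L) no-lone ⟩
    6 * n + 0                             ∎
    where
    open ≤-Reasoning
    no-lone : loneCount ≡ 0
    no-lone with loneCount in eq
    ... | zero  = refl
    ... | suc _ with d , l ← ∑ᴰ-pos (λ d → 𝟙 (loneRep? d)) (subst (1 ≤_) (sym eq) (s≤s z≤n)) =
      contradiction (proj₁ (proj₁ (𝟙-pos (loneRep? d) l))) (>⇒≢ (δ≥2 (source d)))

  leafless-count : ∀ {i r m} → 2 ≤ i → i + r ≡ 6 + m → (∀ v → i ≤ degree G v) → m * n + 12 ≤ coefficient i r * a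
  leafless-count {i} {r} {m} 2≤i i+r≡6+m δ≥i = begin
    m * n + 12                   ≤⟨ +-monoʳ-≤ (m * n) (*-monoʳ-≤ 12 c≥1) ⟩
    m * n + 12 * c               ≤⟨ combine {m} {n} {E} (subst (λ k → k * n ≤ 2 * E + coefficient i r * a) i+r≡6+m (degree-bound i r δ≥i))
                                                       (leafless-bound λ v → ≤-trans 2≤i (δ≥i v)) ⟩
    coefficient i r * a + 0      ≡⟨ +-identityʳ _ ⟩
    coefficient i r * a          ∎
    where open ≤-Reasoning

  δ2-bound : (∀ v → 2 ≤ degree G v) → 3 * (n + 4) ≤ 55 * a
  δ2-bound δ≥2 = ≤-trans (≤-reflexive (*-distribˡ-+ 3 n 4)) (leafless-count {2} {7} {3} (m≤m+n 2 0) refl δ≥2)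

  δ3-bound : (∀ v → 3 ≤ degree G v) → 1 * (n + 4) ≤ 16 * a
  δ3-bound δ≥3 = *-cancelˡ-≤ 3 (begin
    3 * (1 * (n + 4))    ≡⟨ trans (cong (3 *_) (*-identityˡ (n + 4))) (*-distribˡ-+ 3 n 4) ⟩
    3 * n + 12           ≤⟨ leafless-count {3} {6} {3} (m≤m+n 2 1) refl δ≥3 ⟩
    48 * a               ≡⟨ *-assoc 3 16 a ⟩
    3 * (16 * a)         ∎)
    where open ≤-Reasoning

  δ4-bound : (∀ v → 4 ≤ degree G v) → 2 * (n + 6) ≤ 23 * a
  δ4-bound δ≥4 = ≤-trans (≤-reflexive (*-distribˡ-+ 2 n 6)) (leafless-count {4} {4} {2} (m≤m+n 2 2) refl δ≥4)

  δ5-bound : (∀ v → 5 ≤ degree G v) → 1 * (n + 12) ≤ 7 * a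
  δ5-bound δ≥5 = ≤-trans (≤-reflexive (*-distribˡ-+ 1 n 12)) (leafless-count {5} {2} {1} (m≤m+n 2 3) refl δ≥5)

  outerplanar-δ2-bound : (∀ v → 2 ≤ degree G v) → HasOuterFaces R → 1 * (n + 3) ≤ 8 * a
  outerplanar-δ2-bound δ≥2 hasOuter = *-cancelˡ-≤ 2 (+-cancelʳ-≤ (4 * n + 2 * E) _ _ (begin
    2 * (1 * (n + 3)) + (4 * n + 2 * E)     ≡⟨ arrange₁ n E ⟩
    -- Threshold 6, where `coefficient 2 4` is 16.
    6 * n + 2 * (E + 3 * 1)                 ≤⟨ +-mono-≤ (degree-bound 2 4 δ≥2) (*-monoʳ-≤ 2 (≤-trans (+-monoʳ-≤ E (*-monoʳ-≤ 3 c≥1)) (outerplanar-bound euler δ≥2 hasOuter))) ⟩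
    2 * E + 16 * a + 2 * (2 * n)            ≡⟨ arrange₂ n E a ⟩
    2 * (8 * a) + (4 * n + 2 * E)           ∎))
    where
    open ≤-Reasoning
    arrange₁ : ∀ n E → 2 * (1 * (n + 3)) + (4 * n + 2 * E) ≡ 6 * n + 2 * (E + 3 * 1)
    arrange₁ = solve-∀
    arrange₂ : ∀ n E a → 2 * E + 16 * a + 2 * (2 * n) ≡ 2 * (8 * a) + (4 * n + 2 * E)
    arrange₂ = solve-∀

  -- Vertices of degree 3 in maximal planar graphs

  module Maximal (maximal : ∀ (H : Graph n) → Planar H → edgeCount H ≤ edgeCount G) where

    -- Otherwise the chord across the corner between `d` and `rot R d` could be added, contrary to
    -- maximality. The face passes this corner along `reverse d` and then `rot R d`.
    corner-closed : ∀ d → target d ≡ target (rot R d) ⊎ Adj G (target d) (target (rot R d))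
    corner-closed d with target d Fin.≟ target (rot R d) | edge? (target d) (target (rot R d))
    ... | yes eq | _     = inj₁ eq
    ... | no _   | yes e = inj₂ e
    ... | no t≢  | no ¬e = contradiction (≤-trans (≤-reflexive (sym edgeCount⁺)) (maximal H (R⁺ , isPlane⁺ δ≥1 (proj₂ planar)))) (n≮n _)
      where open AddChord R (reverse d) (rot R d) (cong (rot R) (reverse-involutive d)) t≢ ¬e

    orbit-closed : (C : Dart G → Set) → (∀ d → C d → C (rot R d)) → ∀ {d e} → Orbit (rot R) d e → C d → C e
    orbit-closed C closed ε              Cd = Cd
    orbit-closed C closed (refl ◅ orbit) Cd = orbit-closed C closed orbit (closed _ Cd)

    -- The orbit of `d` under `rot` is then covered by `d` and `rot R d`, and it contains every dart
    -- at the source.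
    rot²-fixed⇒degree≤2 : ∀ d → rot R (rot R d) ≡ d → degree G (source d) ≤ 2
    rot²-fixed⇒degree≤2 d fixed = begin
      degree G v                                              ≡⟨ degree-∑ G v ⟩
      ∑ (λ u → 𝟙 (edge? v u))                                ≤⟨ (∑-mono λ u → covered u (edge? v u)) ⟩
      ∑ (λ u → 𝟙 (target d Fin.≟ u) + 𝟙 (target (rot R d) Fin.≟ u)) ≡⟨ trans (∑-+ _ _) (cong₂ _+_ (∑-𝟙-point (target d)) (∑-𝟙-point (target (rot R d)))) ⟩
      2                                                       ∎
      where
      open ≤-Reasoning
      v = source d
      C : Dart G → Set
      C e = e ≡ d ⊎ e ≡ rot R d
      closed : ∀ e → C e → C (rot R e)
      closed e (inj₁ refl) = inj₂ refl
      closed e (inj₂ refl) = inj₁ fixed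
      covered : ∀ u (uv : Dec (Adj G v u)) → 𝟙 uv ≤ 𝟙 (target d Fin.≟ u) + 𝟙 (target (rot R d) Fin.≟ u)
      covered u (no _)   = z≤n
      covered u (yes vu) with orbit-closed C closed (rot-cyclic R d (dart v u vu) refl) (inj₁ refl)
      ... | inj₁ eq = ≤-trans (≤-reflexive (sym (𝟙-yes (target d Fin.≟ u) (sym (cong target eq))))) (m≤m+n _ _)
      ... | inj₂ eq = ≤-trans (≤-reflexive (sym (𝟙-yes (target (rot R d) Fin.≟ u) (sym (cong target eq))))) (m≤n+m _ _)

    four-neighbours : ∀ {u p q r s} → Adj G u p → Adj G u q → Adj G u r → Adj G u s →
                      p ≢ q → p ≢ r → p ≢ s → q ≢ r → q ≢ s → r ≢ s → 4 ≤ degree G u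
    four-neighbours {u} {p} {q} {r} {s} up uq ur us p≢q p≢r p≢s q≢r q≢s r≢s = begin
      4                                          ≤⟨ ∑ᴰ-unique (λ d → 𝟙 (u Fin.≟ source d)) {dart u p up ∷ dart u q uq ∷ dart u r ur ∷ dart u s us ∷ []}
                                                      ((apart p≢q ∷ apart p≢r ∷ apart p≢s ∷ []) ∷ (apart q≢r ∷ apart q≢s ∷ [])
                                                        ∷ (apart r≢s ∷ []) ∷ [] ∷ [])
                                                      (at up ∷ at uq ∷ at ur ∷ at us ∷ []) ⟩
      ∑ᴰ (λ d → 𝟙 (u Fin.≟ source d))           ≡⟨ ∑ᴰ-degree G (λ v → 𝟙 (u Fin.≟ v)) ⟩
      ∑ (λ v → 𝟙 (u Fin.≟ v) * degree G v)      ≡⟨ ∑-point u (degree G) ⟩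
      degree G u                                 ∎
      where
      open ≤-Reasoning
      apart : ∀ {i j} {ui : Adj G u i} {uj : Adj G u j} → i ≢ j → dart {G = G} u i ui ≢ dart u j uj
      apart i≢j refl = i≢j refl
      at : ∀ {w} (uw : Adj G u w) → 1 ≤ 𝟙 (u Fin.≟ source (dart {G = G} u w uw))
      at uw = ≤-reflexive (sym (𝟙-yes (u Fin.≟ u) refl))

    -- The neighbours of v preceding and following u in the rotation are adjacent to u, so with v they exhaust the neighbours of u.
    cubic-closed : ∀ {v u w} → degree G v ≡ 3 → degree G u ≡ 3 → Adj G v u → Adj G u w → w ≡ v ⊎ Adj G v w
    cubic-closed {v} {u} {w} dv du vu uw = case w Fin.≟ v of λ
      { (yes w≡v) → inj₁ w≡v
      ; (no w≢v)  → inj₂ (case w Fin.≟ next of λ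
          { (yes refl) → v-next
          ; (no w≢next) → case w Fin.≟ prev of λ
              { (yes refl) → v-prev
              ; (no w≢prev) → contradiction du (>⇒≢ (four-neighbours (symm G v u vu) u-next u-prev uw
                  v≢next v≢prev (w≢v ∘ sym) next≢prev (w≢next ∘ sym) (w≢prev ∘ sym)))
              }
          })
      }
      where
      d d⁺ d⁻ : Dart G
      d  = dart v u vu
      d⁺ = rot R d
      d⁻ = Inverse.from (rotation R) d
      next prev : Fin n
      next = target d⁺
      prev = target d⁻
      rot-d⁻ : rot R d⁻ ≡ d
      rot-d⁻ = Inverse.strictlyInverseˡ (rotation R) d
      source-d⁻ : source d⁻ ≡ v
      source-d⁻ = trans (sym (rot-source R d⁻)) (cong source rot-d⁻)
      v-next : Adj G v next
      v-next = subst (λ x → Adj G x next) (rot-source R d) (edge d⁺)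
      v-prev : Adj G v prev
      v-prev = subst (λ x → Adj G x prev) source-d⁻ (edge d⁻)
      v≢next : v ≢ next
      v≢next eq = irrefl G v (subst (Adj G v) (sym eq) v-next)
      v≢prev : v ≢ prev
      v≢prev eq = irrefl G v (subst (Adj G v) (sym eq) v-prev)
      not-fixed : ∀ e → source e ≡ v → rot R e ≢ e
      not-fixed e refl fixed with () ← trans (sym dv) (rot-fixed⇒leaf e fixed)
      u≢next : u ≢ next
      u≢next eq = not-fixed d refl (sym (dart-≡ (sym (rot-source R d)) eq))
      prev≢u : prev ≢ u
      prev≢u eq = not-fixed d⁻ source-d⁻ (trans rot-d⁻ (dart-≡ (sym source-d⁻) (sym eq)))
      next≢prev : next ≢ prev
      -- If the two coincided, `rot` would return to `d⁻` after two steps and `v` would have degree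
      -- at most 2.
      next≢prev eq = contradiction (rot²-fixed⇒degree≤2 d⁻ (trans (cong (rot R) rot-d⁻) (dart-≡ (trans (rot-source R d) (sym source-d⁻)) eq)))
                                   (<⇒≱ (≤-reflexive (sym (trans (cong (degree G) source-d⁻) dv))))
      u-next : Adj G u next
      u-next = [ (λ eq → contradiction eq u≢next) , (λ e → e) ]′ (corner-closed d)
      u-prev : Adj G u prev
      u-prev = symm G prev u ([ (λ eq → contradiction (trans eq (cong target rot-d⁻)) prev≢u) , subst (Adj G prev ∘ target) rot-d⁻ ]′ (corner-closed d⁻))

    -- A vertex of degree 3 all of whose neighbours have degree 3 lies in a component K₄, which is counted at its representative.
    InK₄ IsK₄Rep : Fin n → Set
    InK₄ v    = degree G v ≡ 3 × (∀ u → Adj G v u → degree G u ≡ 3)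
    IsK₄Rep v = InK₄ v × rep (comp v) ≡ v

    isK₄Rep? : ∀ v → Dec (IsK₄Rep v)
    isK₄Rep? v = ((degree G v ≟ 3) ×-dec Fin.all? (λ u → edge? v u →-dec (degree G u ≟ 3))) ×-dec (rep (comp v) Fin.≟ v)

    K₄Count : ℕ
    K₄Count = ∑ (λ v → 𝟙 (isK₄Rep? v))

    K₄Count≤c : K₄Count ≤ c
    K₄Count≤c = ≤-trans (∑-mono λ v → 𝟙-mono (isK₄Rep? v) (rep (comp v) Fin.≟ v) proj₂) repCount

    -- By `cubic-closed` the closed neighbourhood of `v` is closed under adjacency and is therefore
    -- the whole component.
    K₄-closed : ∀ {v} → InK₄ v → ∀ {w} → Connected G v w → w ≡ v ⊎ Adj G v w
    K₄-closed {v} (dv , dN) conn = connected-closed {G = G} (λ w → w ≡ v ⊎ Adj G v w) closed conn (inj₁ refl)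
      where
      closed : ∀ {u w} → u ≡ v ⊎ Adj G v u → Adj G u w → w ≡ v ⊎ Adj G v w
      closed (inj₁ refl) vw = inj₂ vw
      closed (inj₂ vu)   uw = cubic-closed dv (dN _ vu) vu uw

    K₄-degree : ∀ {v} → InK₄ v → ∀ {w} → Connected G v w → degree G w ≡ 3
    K₄-degree {v} (dv , dN) {w} conn = [ (λ { refl → dv }) , dN w ]′ (K₄-closed (dv , dN) conn)

    -- All vertices of the component have degree 3, so the property passes from `v` to the
    -- representative at which the component is counted.
    K₄-rep : ∀ {v} → InK₄ v → IsK₄Rep (rep (comp v))
    K₄-rep {v} inK₄ = (K₄-degree inK₄ to-rep , λ u ru → K₄-degree inK₄ (to-rep ◅◅ ru ◅ ε)) , cong rep (comp-rep (comp v))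
      where
      to-rep : Connected G v (rep (comp v))
      to-rep = connected (sym (comp-rep (comp v)))

    n₃-bound : degreeCount G 3 ≤ a + K₄Count
    n₃-bound = begin
      degreeCount G 3                                     ≤⟨ ∑-mono split ⟩
      ∑ (λ v → 𝟙 (kept? v) + 𝟙 (isK₄Rep? v))                ≡⟨ ∑-+ _ _ ⟩
      ∑ (λ v → 𝟙 (kept? v)) + K₄Count                        ≤⟨ +-monoˡ-≤ K₄Count (α-reg-≥ G kept? 2 (λ { u v (du , _) (dv , _) → trans du (sym dv) }) sparse) ⟩
      a + K₄Count                                         ∎
      where
      open ≤-Reasoning
      Kept : Fin n → Set
      Kept v = degree G v ≡ 3 × ¬ IsK₄Rep v
      kept? : ∀ v → Dec (Kept v)
      kept? v = (degree G v ≟ 3) ×-dec ¬? (isK₄Rep? v)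
      split : ∀ v → 𝟙 (degree G v ≟ 3) ≤ 𝟙 (kept? v) + 𝟙 (isK₄Rep? v)
      split v = case isK₄Rep? v of λ
        { (yes r) → ≤-trans (𝟙-mono (degree G v ≟ 3) (isK₄Rep? v) (λ _ → r)) (m≤n+m _ _)
        ; (no ¬r) → ≤-trans (𝟙-mono (degree G v ≟ 3) (kept? v) (_, ¬r)) (m≤m+n _ _)
        }
      -- If all neighbours of `v` were kept, its component would be K₄. The representative, which is
      -- not kept, would then be `v` or a neighbour of `v`.
      not-all : ∀ v → Kept v → ¬ (∀ u → Adj G v u → Kept u)
      not-all v (dv , ¬rep) PN = [ (λ eq → ¬rep (subst IsK₄Rep eq (K₄-rep inK₄))) , (λ vr → proj₂ (PN _ vr) (K₄-rep inK₄)) ]′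
                                  (K₄-closed inK₄ (connected (sym (comp-rep (comp v)))))
        where
        inK₄ : InK₄ v
        inK₄ = dv , λ u vu → proj₁ (PN u vu)
      sparse : ∀ v → Kept v → ∑ (λ u → 𝟙 (edge? v u) * 𝟙 (kept? u)) ≤ 2
      -- The neighbour `u₀` that is not kept uses up one of the three neighbours of `v`.
      sparse v Pv with u₀ , bad ← Fin.¬∀⟶∃¬ n _ (λ u → edge? v u →-dec kept? u) (not-all v Pv) = +-cancelʳ-≤ 1 _ _ (begin
        ∑ (λ u → 𝟙 (edge? v u) * 𝟙 (kept? u)) + 1                               ≡⟨ cong₂ _+_ refl (∑-𝟙-point u₀) ⟨
        ∑ (λ u → 𝟙 (edge? v u) * 𝟙 (kept? u)) + ∑ (λ u → 𝟙 (u₀ Fin.≟ u))       ≡⟨ ∑-+ _ _ ⟨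
        ∑ (λ u → 𝟙 (edge? v u) * 𝟙 (kept? u) + 𝟙 (u₀ Fin.≟ u))                 ≤⟨ ∑-mono below ⟩
        ∑ (λ u → 𝟙 (edge? v u))                                               ≡⟨ trans (sym (degree-∑ G v)) (proj₁ Pv) ⟩
        3                                                                      ∎)
        where
        vu₀ : Adj G v u₀
        vu₀ = decidable-stable (edge? v u₀) λ ¬e → bad λ e → contradiction e ¬e
        ¬Pu₀ : ¬ Kept u₀
        ¬Pu₀ Pu₀ = bad λ _ → Pu₀
        below : ∀ u → 𝟙 (edge? v u) * 𝟙 (kept? u) + 𝟙 (u₀ Fin.≟ u) ≤ 𝟙 (edge? v u)
        below u = 𝟙-drop (edge? v u) (kept? u) (u₀ Fin.≟ u) (λ { refl → vu₀ }) λ { refl → ¬Pu₀ }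

    -- If K₄ is the only component, the graph is cubic and two colour classes cover it.
    K₄-cases : K₄Count ≡ 0 ⊎ 2 ≤ c ⊎ n ≤ 2 * a
    K₄-cases with K₄Count in eq | one-or-more c≥1
    ... | zero  | _        = inj₁ refl
    ... | suc _ | inj₂ 2≤c = inj₂ (inj₁ 2≤c)
    ... | suc _ | inj₁ c≡1 with v , l ← ∑-pos (λ v → 𝟙 (isK₄Rep? v)) (subst (1 ≤_) (sym eq) (s≤s z≤n)) =
      inj₂ (inj₂ (regular⇒n≤ 3 λ w → K₄-degree (proj₁ (𝟙-pos (isK₄Rep? v) l)) (connected-if-single c≡1 v w)))

    maximal-δ3-bound : (∀ v → 3 ≤ degree G v) → 1 * (n + 6) ≤ 14 * a
    maximal-δ3-bound δ≥3 = [ general ∘ inj₁ , [ general ∘ inj₂ , tiny ]′ ]′ K₄-cases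
      where
      open ≤-Reasoning
      n₃ = degreeCount G 3
      tiny : n ≤ 2 * a → 1 * (n + 6) ≤ 14 * a
      tiny n≤2a = begin
        1 * (n + 6)          ≡⟨ *-identityˡ (n + 6) ⟩
        n + 6 * 1            ≤⟨ +-mono-≤ n≤2a (*-monoʳ-≤ 6 (≤-trans n≥1 n≤2a)) ⟩
        2 * a + 6 * (2 * a)  ≡⟨ arrange a ⟩
        14 * a               ∎
        where
        arrange : ∀ a → 2 * a + 6 * (2 * a) ≡ 14 * a
        arrange = solve-∀
      general : K₄Count ≡ 0 ⊎ 2 ≤ c → 1 * (n + 6) ≤ 14 * a
      -- Threshold 8. The weight of degree 3 is 5, so each K₄ costs exactly the 5 units allowed by
      -- `component-slack`; the factor of `a` is 5 + 23 = 2 * 14.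
      general slack = *-cancelˡ-≤ 2 (+-cancelʳ-≤ (5 * K₄Count) _ _ (begin
        2 * (1 * (n + 6)) + 5 * K₄Count               ≡⟨ arrange₁ n K₄Count ⟩
        2 * n + (12 + 5 * K₄Count)                    ≤⟨ +-monoʳ-≤ (2 * n) (component-slack c≥1 K₄Count≤c slack) ⟩
        2 * n + 12 * c                                ≤⟨ combine {2} {n} {E} (degree-count 3 5 δ≥3) (leafless-bound λ v → ≤-trans (n≤1+n 2) (δ≥3 v)) ⟩
        5 * n₃ + weightedCount 4 4 + 0                ≤⟨ +-monoˡ-≤ 0 (+-mono-≤ (*-monoʳ-≤ 5 n₃-bound) (weightedCount≤ 4 4)) ⟩
        5 * (a + K₄Count) + 23 * a + 0                ≡⟨ arrange₂ a K₄Count ⟩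
        2 * (14 * a) + 5 * K₄Count                    ∎))
        where
        arrange₁ : ∀ n k → 2 * (1 * (n + 6)) + 5 * k ≡ 2 * n + (12 + 5 * k)
        arrange₁ = solve-∀
        arrange₂ : ∀ a k → 5 * (a + k) + 23 * a + 0 ≡ 2 * (14 * a) + 5 * k
        arrange₂ = solve-∀

mainTheorem5 : ∀ (n : ℕ) (G : Graph n) (δ : ℕ) → IsMinDegree G δ →
    ( Planar G →
    (δ ≡ 1 → + (α-reg 2 G) ℚ./ 1 ℚ.≥ (+ 4 ℚ./ 83) ℚ.* (+ (n + 3) ℚ./ 1))
    × (δ ≡ 2 → + (α-reg 2 G) ℚ./ 1 ℚ.≥ (+ 3 ℚ./ 55) ℚ.* (+ (n + 4) ℚ./ 1))
    × (δ ≡ 3 → + (α-reg 2 G) ℚ./ 1 ℚ.≥ (+ 1 ℚ./ 16) ℚ.* (+ (n + 4) ℚ./ 1))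
    × (δ ≡ 4 → + (α-reg 2 G) ℚ./ 1 ℚ.≥ (+ 2 ℚ./ 23) ℚ.* (+ (n + 6) ℚ./ 1))
    × (δ ≡ 5 → + (α-reg 2 G) ℚ./ 1 ℚ.≥ (+ 1 ℚ./ 7) ℚ.* (+ (n + 12) ℚ./ 1))
    × (MaximalPlanar G → δ ≡ 3 → + (α-reg 2 G) ℚ./ 1 ℚ.≥ (+ 1 ℚ./ 14) ℚ.* (+ (n + 6) ℚ./ 1)))
    × ( Outerplanar G → δ ≡ 2 → + (α-reg 2 G) ℚ./ 1 ℚ.≥ (+ 1 ℚ./ 8) ℚ.* (+ (n + 3) ℚ./ 1))
mainTheorem5 n G δ ((v₀ , _) , δ-min) =
    (λ planar →
        (λ { refl → fraction-≥ 4 82 (n + 3) a (δ1-bound planar δ-min) })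
      , (λ { refl → fraction-≥ 3 54 (n + 4) a (δ2-bound planar (weaken (s≤s z≤n)) δ-min) })
      , (λ { refl → fraction-≥ 1 15 (n + 4) a (δ3-bound planar (weaken (s≤s z≤n)) δ-min) })
      , (λ { refl → fraction-≥ 2 22 (n + 6) a (δ4-bound planar (weaken (s≤s z≤n)) δ-min) })
      , (λ { refl → fraction-≥ 1 6 (n + 12) a (δ5-bound planar (weaken (s≤s z≤n)) δ-min) })
      , (λ { (_ , maximal) refl → fraction-≥ 1 13 (n + 6) a (Maximal.maximal-δ3-bound planar (weaken (s≤s z≤n)) maximal δ-min) }))
  , λ { (R , plane , hasOuter) refl → fraction-≥ 1 7 (n + 3) a (outerplanar-δ2-bound (R , plane) (weaken (s≤s z≤n)) δ-min hasOuter) }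
  where
  open PlanarBounds {G = G} v₀
  a : ℕ
  a = α-reg 2 G
  weaken : 1 ≤ δ → ∀ v → 1 ≤ degree G v
  weaken 1≤δ v = ≤-trans 1≤δ (δ-min v)
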